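{- For every integer $k \ge 1$ there exists $n_0 = n_0(k)$ such that for all $n \ge n_0$, $$D(n, C_{2k+1}) = 2^{\lfloor n^2/4 \rfloor}.$$
   Context: An orientation of a (simple, undirected) graph $G$ is obtained by assigning a direction to each edge of $G$. $C_{2k+1}$ denotes the directed cycle of length $2k+1$, i.e. the cycle $v_1 v_2 \cdots v_{2k+1} v_1$ with every edge oriented $v_i \to v_{i+1}$ (indices mod $2k+1$). An orientation is $C_{2k+1}$-free if it contains no directed cycle of length $2k+1$ as a subgraph. For an oriented graph $H$, $D(n,H)$ denotes the maximum, over all graphs $G$ on $n$ vertices, of the number of orientations of $G$ that contain no copy of $H$. -}

module Defs where

open import Data.Bool using (Bool; true; false; if_then_else_)
open import Data.Nat using (ℕ; zero; suc; _<_; _<?_)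
open import Data.Fin using (Fin; toℕ) renaming (_≟_ to _≟ᶠ_)
open import Data.List using (List; []; _∷_; [_]; _++_; length; map; filter; concatMap; cartesianProduct)
open import Data.List.Relation.Unary.Any using (Any; any?)
open import Data.List.Relation.Unary.Unique.Propositional using (Unique)
import Data.List.Relation.Unary.Unique.DecPropositional as UniqueDec
open import Data.Vec using (Vec; toList)
open import Data.Vec.Functional as VF using ()
import Data.Vec as V
open import Data.Fin.Base using () renaming (zero to fzero)
open import Data.Product using (Σ; _×_; _,_; ∃)
open import Data.Product.Properties using (≡-dec)
open import Data.Unit using (⊤; tt)
open import Data.Empty using (⊥)
open import Relation.Binary.PropositionalEquality using (_≡_)
open import Relation.Nullary using (Dec; yes; no; ¬_; ¬?)
open import Relation.Nullary.Decidable using (_×-dec_)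
open import Data.List.Fresh using ()
import Data.List.Membership.DecPropositional as MemDec
open import Data.List.Membership.Propositional using (_∈_)
open import Data.Fin.Properties using (all?)

record Graph (n : ℕ) : Set where
  field
    adj     : Fin n → Fin n → Bool
    sym     : ∀ u v → adj u v ≡ adj v u
    irrefl  : ∀ v → adj v v ≡ false
open Graph public

pairs : (n : ℕ) → List (Fin n × Fin n)
pairs n = filter (λ p → toℕ (Data.Product.proj₁ p) <? toℕ (Data.Product.proj₂ p))
                 (cartesianProduct (Data.List.allFin n) (Data.List.allFin n))
  where import Data.List

edges : ∀ {n} → Graph n → List (Fin n × Fin n)
edges {n} G = filter (λ p → adj G (Data.Product.proj₁ p) (Data.Product.proj₂ p) Data.Bool.≟ true) (pairs n)
  where import Data.Bool

-- An orientation of G: one Boolean per edge (i , j) (i < j);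
-- true means the edge is directed i → j, false means j → i.
-- Distinct vectors give distinct orientations, and every orientation arises.
Orientation : ∀ {n} → Graph n → Set
Orientation G = Vec Bool (length (edges G))

arcs : ∀ {n} (G : Graph n) → Orientation G → List (Fin n × Fin n)
arcs G o = go (edges G) (toList o)
  where
  go : ∀ {n} → List (Fin n × Fin n) → List Bool → List (Fin n × Fin n)
  go ((i , j) ∷ es) (b ∷ bs) = (if b then (i , j) else (j , i)) ∷ go es bs
  go _ _ = []

Arc : ∀ {n} (G : Graph n) → Orientation G → Fin n → Fin n → Set
Arc G o u v = (u , v) ∈ arcs G o

DirPath : ∀ {n} (G : Graph n) → Orientation G → List (Fin n) → Set
DirPath G o (x ∷ y ∷ rest) = Arc G o x y × DirPath G o (y ∷ rest)
DirPath G o _ = ⊤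

DirClosed : ∀ {n} (G : Graph n) → Orientation G → List (Fin n) → Set
DirClosed G o []       = ⊤
DirClosed G o (v ∷ vs) = DirPath G o ((v ∷ vs) ++ [ v ])

HasDirCycle : ∀ {n} (G : Graph n) → Orientation G → ℕ → Set
HasDirCycle {n} G o L =
  Σ (Vec (Fin n) L) λ c → Unique (toList c) × DirClosed G o (toList c)

CycleFree : ∀ {n} (G : Graph n) → Orientation G → ℕ → Set
CycleFree G o L = ¬ HasDirCycle G o L

private
  pair-≟ : ∀ {n} (p q : Fin n × Fin n) → Dec (p ≡ q)
  pair-≟ = ≡-dec _≟ᶠ_ _≟ᶠ_

  arc? : ∀ {n} (G : Graph n) (o : Orientation G) u v → Dec (Arc G o u v)
  arc? G o u v = MemDec._∈?_ pair-≟ (u , v) (arcs G o)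

  path? : ∀ {n} (G : Graph n) (o : Orientation G) xs → Dec (DirPath G o xs)
  path? G o []             = yes tt
  path? G o (x ∷ [])       = yes tt
  path? G o (x ∷ y ∷ rest) = arc? G o x y ×-dec path? G o (y ∷ rest)

  closed? : ∀ {n} (G : Graph n) (o : Orientation G) xs → Dec (DirClosed G o xs)
  closed? G o []       = yes tt
  closed? G o (v ∷ vs) = path? G o ((v ∷ vs) ++ [ v ])

  allVecs : ∀ {A : Set} → List A → (L : ℕ) → List (Vec A L)
  allVecs xs zero    = V.[] ∷ []
  allVecs xs (suc L) = concatMap (λ x → map (x V.∷_) (allVecs xs L)) xs

  allFinL : (n : ℕ) → List (Fin n)
  allFinL n = Data.List.allFin n
    where import Data.List

  allVecs-complete : ∀ {n} L (c : Vec (Fin n) L) → c ∈ allVecs (allFinL n) L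
  allVecs-complete zero V.[] = Any.here _≡_.refl
    where import Data.List.Relation.Unary.Any as Any
  allVecs-complete {n} (suc L) (x V.∷ c) =
    Mem.∈-concatMap⁺ (λ y → map (y V.∷_) (allVecs (allFinL n) L)) {xs = allFinL n}
      (Any.map (λ { _≡_.refl → Mem.∈-map⁺ (x V.∷_) (allVecs-complete L c) })
               (Mem.∈-allFin x))
    where
    import Data.List.Relation.Unary.Any as Any
    import Data.List.Membership.Propositional.Properties as Mem

  cycle? : ∀ {n} (G : Graph n) (o : Orientation G) L → Dec (HasDirCycle G o L)
  cycle? {n} G o L with any? (λ c → UniqueDec.unique? _≟ᶠ_ (toList c) ×-dec closed? G o (toList c))
                              (allVecs (allFinL n) L)
  ... | yes p = let (c , _ , q) = find p in yes (c , q)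
    where open import Data.List.Membership.Propositional using (find)
  ... | no ¬p = no λ { (c , q) → ¬p (lose (allVecs-complete L c) q) }
    where open import Data.List.Membership.Propositional using (lose)

freeCount : ∀ {n} → Graph n → ℕ → ℕ
freeCount G L =
  length (filter (λ o → ¬? (cycle? G o L)) (allVecs (true ∷ false ∷ []) (length (edges G))))

D≡ : ℕ → ℕ → ℕ → Set
D≡ n L m = (∀ (G : Graph n) → freeCount G L Data.Nat.≤ m)
         × Σ (Graph n) (λ G → freeCount G L ≡ m)
  where import Data.Nat

{-# OPTIONS --safe #-}
module Submission where

-- Fix the graph and call an orientation good if all degrees are at least about n/2, all
-- in- and outdegrees are linear, every large constant-size set Q has about n/2 vertices
-- (the set K(Q)) joined to it many times in both directions, and for every arc x → y with
-- few w satisfying y → w → x the set N(x) ∪ N(y) is substantially larger than n/2.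
-- An orientation violating one of these conditions at an r-tuple T is determined by its
-- restriction to the other vertices and by one of at most 2^(rn/2 - n/64) patterns at T, so
-- bad orientations are rare by induction on n.
--
-- A good orientation without a directed (2k+1)-cycle forces the graph to be bipartite.
-- Climbing S, S′ ⊂ K(S), S″ ⊂ K(S′), … and descending again yields directed paths of any
-- even length with both ends in S, so every robust way to close a directed triangle yields
-- a (2k+1)-cycle.  Hence Q ⊂ N⁺(x) or Q ⊂ N⁻(x) implies that K(Q) and N(x) are almost
-- disjoint.  If N(x) and N(y) share many vertices, they share such a Q, so both are close to
-- the complement of K(Q); for adjacent x, y this contradicts goodness, so N(x) and N(y) are
-- almost disjoint.  As all of these sets have density about 1/2, the neighbourhoods
-- fall into two classes, and adjacent vertices lie in different ones.  A bipartite graph has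
-- at most n²/4 edges.  Therefore either the bound holds outright, or all orientations are
-- bad and the excess over 2^(n²/4) at least halves; the excess thus vanishes for large n.

open import Defs hiding (sym)
open import Data.Bool using (Bool; true; false; if_then_else_; not; _∧_; _∨_; _xor_; T)
import Data.Bool.Properties as Bool
open import Data.Empty using (⊥; ⊥-elim)
open import Data.Fin using (Fin; toℕ) renaming (_≟_ to _≟ᶠ_)
open import Data.Fin.Properties using (toℕ-injective)
open import Data.List using (List; []; _∷_; length; filter; map; _++_; concatMap; allFin; cartesianProduct; cartesianProductWith; tabulate)
open import Data.List.Membership.Propositional using (_∈_; _∉_)
open import Data.List.Membership.Propositional.Properties using (∈-++⁺ˡ; ∈-++⁺ʳ; ∈-++⁻; ∈-map⁺; ∈-map⁻; ∈-filter⁺; ∈-filter⁻; ∈-allFin; ∈-cartesianProduct⁺; ∈-cartesianProduct⁻; ∈-cartesianProductWith⁺; ∈-cartesianProductWith⁻)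
import Data.List.Membership.DecPropositional as MemDec
import Data.List.Properties as List
open import Data.List.Properties using (length-++; length-map; length-tabulate; map-tabulate; filter-all; filter-accept; filter-reject; ∷-injectiveˡ; ∷-injectiveʳ)
open import Data.List.Relation.Binary.Sublist.Propositional using (_⊆_; []; _∷_; _∷ʳ_; ⊆-trans; ⊆-refl)
import Data.List.Relation.Binary.Sublist.Propositional as Sub
open import Data.List.Relation.Binary.Sublist.Propositional.Properties using (filter-⊆)
open import Data.List.Relation.Unary.All as All using (All; []; _∷_)
open import Data.List.Relation.Unary.AllPairs using (AllPairs; []; _∷_)
open import Data.List.Relation.Unary.Any using (here; there)
open import Data.List.Relation.Unary.Unique.Propositional using (Unique)
import Data.List.Relation.Unary.Unique.Propositional.Properties as Unique
import Data.List.Relation.Unary.Unique.DecPropositional as UniqueDec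
open import Data.Nat
open import Data.Nat.DivMod using (m*n/n≡m; /-monoˡ-≤; m/n*n≤m; m/n≤m; m≡m%n+[m/n]*n; m%n<n; m<n*o⇒m/o<n)
open import Data.Nat.Induction using (<-rec)
open import Data.Nat.Properties
open import Data.Nat.Tactic.RingSolver using (solve-∀)
open import Data.Product using (Σ; ∃; _×_; _,_; proj₁; proj₂)
open import Data.Product.Properties using (≡-dec; ,-injectiveˡ; ,-injectiveʳ)
open import Data.Sum as Sum using (_⊎_; inj₁; inj₂)
open import Data.Unit using (tt)
open import Data.Vec as Vec using (Vec; []; _∷_; toList)
import Data.Vec.Properties as Vec
open import Function using (_∘_; id; Equivalence)
open import Relation.Binary using (DecidableEquality; tri<; tri≈; tri>)
open import Relation.Binary.PropositionalEquality
open import Relation.Nullary using (Dec; yes; no; does; ¬_; ¬?; contradiction)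

open ≤-Reasoning

private variable
  X Y : Set
  f g : X → ℕ

-- Finite sums, products and counts

∑ ∏ : (X → ℕ) → List X → ℕ
∑ f []       = 0
∑ f (x ∷ xs) = f x + ∑ f xs
∏ f []       = 1
∏ f (x ∷ xs) = f x * ∏ f xs

^-distribʳ-* : ∀ o m n → (m * n) ^ o ≡ m ^ o * n ^ o
^-distribʳ-* zero    m n = refl
^-distribʳ-* (suc o) m n rewrite ^-distribʳ-* o m n = interchange m n (m ^ o) (n ^ o)
  where
  interchange : ∀ a b c d → a * b * (c * d) ≡ a * c * (b * d)
  interchange = solve-∀

bit : Bool → ℕ
bit true  = 1
bit false = 0

count : (X → Bool) → List X → ℕ
count p = ∑ (λ x → bit (p x))

∑-mono : ∀ xs → (∀ {x} → x ∈ xs → f x ≤ g x) → ∑ f xs ≤ ∑ g xs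
∑-mono []       h = z≤n
∑-mono (x ∷ xs) h = +-mono-≤ (h (here refl)) (∑-mono xs (h ∘ there))

∏-mono : ∀ xs → (∀ {x} → x ∈ xs → f x ≤ g x) → ∏ f xs ≤ ∏ g xs
∏-mono []       h = ≤-refl
∏-mono (x ∷ xs) h = *-mono-≤ (h (here refl)) (∏-mono xs (h ∘ there))

∑-+ : ∀ (f g : X → ℕ) xs → ∑ (λ x → f x + g x) xs ≡ ∑ f xs + ∑ g xs
∑-+ f g []       = refl
∑-+ f g (x ∷ xs) rewrite ∑-+ f g xs = interchange (f x) (g x) (∑ f xs) (∑ g xs)
  where
  interchange : ∀ a b c d → a + b + (c + d) ≡ a + c + (b + d)
  interchange = solve-∀

∏-* : ∀ (f g : X → ℕ) xs → ∏ (λ x → f x * g x) xs ≡ ∏ f xs * ∏ g xs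
∏-* f g []       = refl
∏-* f g (x ∷ xs) rewrite ∏-* f g xs = interchange (f x) (g x) (∏ f xs) (∏ g xs)
  where
  interchange : ∀ a b c d → a * b * (c * d) ≡ a * c * (b * d)
  interchange = solve-∀

∑-*ʳ : ∀ (f : X → ℕ) c xs → ∑ (λ x → f x * c) xs ≡ ∑ f xs * c
∑-*ʳ f c []       = refl
∑-*ʳ f c (x ∷ xs) rewrite ∑-*ʳ f c xs = sym (*-distribʳ-+ c (f x) (∑ f xs))

∑-const : ∀ c (xs : List X) → ∑ (λ _ → c) xs ≡ length xs * c
∑-const c []       = refl
∑-const c (x ∷ xs) = cong (c +_) (∑-const c xs)

∏-const : ∀ c (xs : List X) → ∏ (λ _ → c) xs ≡ c ^ length xs
∏-const c []       = refl
∏-const c (x ∷ xs) = cong (c *_) (∏-const c xs)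

∏-≤-^ : ∀ c (xs : List X) → (∀ {x} → x ∈ xs → f x ≤ c) → ∏ f xs ≤ c ^ length xs
∏-≤-^ c xs h = ≤-trans (∏-mono xs h) (≤-reflexive (∏-const c xs))

∏-if : ∀ (p : X → Bool) a b xs →
  ∏ (λ x → if p x then a else b) xs ≡ a ^ count p xs * b ^ count (not ∘ p) xs
∏-if p a b []       = refl
∏-if p a b (x ∷ xs) with p x
... | true  rewrite ∏-if p a b xs = sym (*-assoc a _ _)
... | false rewrite ∏-if p a b xs = swap b (a ^ count p xs) (b ^ count (not ∘ p) xs)
  where
  swap : ∀ u v w → u * (v * w) ≡ v * (u * w)
  swap = solve-∀

∑-member : ∀ (f : X → ℕ) {x xs} → x ∈ xs → f x ≤ ∑ f xs
∑-member f (here refl) = m≤m+n _ _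
∑-member f (there x∈) = ≤-trans (∑-member f x∈) (m≤n+m _ _)

∑-++ : ∀ (f : X → ℕ) xs ys → ∑ f (xs ++ ys) ≡ ∑ f xs + ∑ f ys
∑-++ f []       ys = refl
∑-++ f (x ∷ xs) ys = trans (cong (f x +_) (∑-++ f xs ys)) (sym (+-assoc (f x) _ _))

∑-map : ∀ (f : Y → ℕ) (h : X → Y) xs → ∑ f (map h xs) ≡ ∑ (f ∘ h) xs
∑-map f h []       = refl
∑-map f h (x ∷ xs) = cong (f (h x) +_) (∑-map f h xs)

count-not : ∀ (p : X → Bool) xs → count p xs + count (not ∘ p) xs ≡ length xs
count-not p []       = refl
count-not p (x ∷ xs) with p x
... | true  = cong suc (count-not p xs)
... | false = trans (+-suc _ _) (cong suc (count-not p xs))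

-- Proof by evaluation: for a concrete `P` the hypothesis reduces to the unit type, so `tt`
-- discharges it.
bool-all : (P : Bool → Bool) → T (P true ∧ P false) → ∀ b → T (P b)
bool-all P h true  with P true
... | true = tt
bool-all P h false with P true | P false
... | true | true = tt

bool-≤ : (f g : Bool → ℕ) → T ((f true ≤ᵇ g true) ∧ (f false ≤ᵇ g false)) → ∀ b → f b ≤ g b
bool-≤ f g h b = ≤ᵇ⇒≤ _ _ (bool-all (λ b → f b ≤ᵇ g b) h b)

∧-left : ∀ {b c} → b ∧ c ≡ true → b ≡ true
∧-left {true} _ = refl

∧-right : ∀ {b c} → b ∧ c ≡ true → c ≡ true
∧-right {true} e = e

-- Double counting

∑-swap : ∀ (h : X → Y → ℕ) xs ys → ∑ (λ x → ∑ (h x) ys) xs ≡ ∑ (λ y → ∑ (λ x → h x y) xs) ys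
∑-swap h xs []       = trans (∑-const 0 xs) (*-zeroʳ (length xs))
∑-swap h xs (y ∷ ys) = trans (∑-+ _ _ xs) (cong (∑ (λ x → h x y) xs +_) (∑-swap h xs ys))

-- Turns a pointwise inequality between indicators into one between set sizes. With `c` the number
-- of sets a point may lie in without causing an overlap, this is a truncated inclusion-exclusion.
count-linear : ∀ c (ps qs : List (X → Bool)) xs →
  (∀ x → ∑ (λ p → bit (p x)) ps ≤ c + ∑ (λ q → bit (q x)) qs) →
  ∑ (λ p → count p xs) ps ≤ length xs * c + ∑ (λ q → count q xs) qs
count-linear c ps qs xs h = begin
  ∑ (λ p → count p xs) ps                             ≡⟨ ∑-swap (λ p x → bit (p x)) ps xs ⟩
  ∑ (λ x → ∑ (λ p → bit (p x)) ps) xs                 ≤⟨ ∑-mono xs (λ {x} _ → h x) ⟩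
  ∑ (λ x → c + ∑ (λ q → bit (q x)) qs) xs             ≡⟨ ∑-+ _ _ xs ⟩
  ∑ (λ _ → c) xs + ∑ (λ x → ∑ (λ q → bit (q x)) qs) xs
    ≡⟨ cong₂ _+_ (∑-const c xs) (∑-swap (λ x q → bit (q x)) xs qs) ⟩
  length xs * c + ∑ (λ q → count q xs) qs             ∎

-- Groups the sum by the value of `code`. Only an inequality holds, since a code repeated in `cs`
-- counts its fibre again.
fibre-sum : ∀ {C : Set} (_≟_ : DecidableEquality C) (code : X → C) (w : C → ℕ) (R : X → ℕ) cs F →
  (∀ {d} → d ∈ F → code d ∈ cs) →
  ∑ (λ d → w (code d) * R d) F ≤ ∑ (λ c → w c * ∑ R (filter (λ d → code d ≟ c) F)) cs
fibre-sum _≟_ code w R cs []      h = z≤n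
fibre-sum {C = C} _≟_ code w R cs (d ∷ F) h = begin
    w (code d) * R d + ∑ (λ d → w (code d) * R d) F
      ≤⟨ +-mono-≤ (≤-trans (≤-reflexive (sym (own _ refl))) (∑-member own-term (h (here refl))))
                  (fibre-sum _≟_ code w R cs F (h ∘ there)) ⟩
    ∑ own-term cs + ∑ (λ c → w c * ∑ R (filter (λ d → code d ≟ c) F)) cs
      ≡⟨ sym (∑-+ _ _ cs) ⟩
    ∑ (λ c → own-term c + w c * ∑ R (filter (λ d → code d ≟ c) F)) cs
      ≤⟨ ∑-mono cs (λ {c} _ → step c) ⟩
    ∑ (λ c → w c * ∑ R (filter (λ d → code d ≟ c) (d ∷ F))) cs ∎
  where
  own-term : C → ℕ
  own-term c = if does (code d ≟ c) then w c * R d else 0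
  own : ∀ c → code d ≡ c → own-term c ≡ w c * R d
  own c e with code d ≟ c
  ... | yes _ = refl
  ... | no ¬e = contradiction e ¬e
  step : ∀ c → own-term c + w c * ∑ R (filter (λ d → code d ≟ c) F)
             ≤ w c * ∑ R (filter (λ d → code d ≟ c) (d ∷ F))
  step c with code d ≟ c
  ... | yes _ = ≤-reflexive (sym (*-distribˡ-+ (w c) (R d) _))
  ... | no  _ = ≤-refl

-- The weights play the role of an exponential moment: a family on which ∏ ω is
-- large must be small.
weighted-split : ∀ {I C : Set} (_≟_ : DecidableEquality C)
  (codes : I → List C) (code : I → X → C) (ω : I → C → ℕ) N is F →
  (∀ {i d} → i ∈ is → d ∈ F → code i d ∈ codes i) →
  (∀ F′ → F′ ⊆ F → (∀ {i d e} → i ∈ is → d ∈ F′ → e ∈ F′ → code i d ≡ code i e) → length F′ ≤ N) →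
  ∑ (λ d → ∏ (λ i → ω i (code i d)) is) F ≤ N * ∏ (λ i → ∑ (ω i) (codes i)) is
weighted-split _≟_ codes code ω N [] F h b = begin
  ∑ (λ _ → 1) F ≡⟨ ∑-const 1 F ⟩
  length F * 1  ≤⟨ *-monoˡ-≤ 1 (b F ⊆-refl (λ ())) ⟩
  N * 1         ∎
weighted-split {X = X} _≟_ codes code ω N (i ∷ is) F h b = begin
    ∑ (λ d → ω i (code i d) * R d) F
      ≤⟨ fibre-sum _≟_ (code i) (ω i) R (codes i) F (h (here refl)) ⟩
    ∑ (λ c → ω i c * ∑ R (fibre c)) (codes i)
      ≤⟨ ∑-mono (codes i) (λ {c} _ → *-monoʳ-≤ (ω i c) (rec c)) ⟩
    ∑ (λ c → ω i c * (N * P)) (codes i)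
      ≡⟨ ∑-*ʳ (ω i) (N * P) (codes i) ⟩
    ∑ (ω i) (codes i) * (N * P)
      ≡⟨ swap (∑ (ω i) (codes i)) N P ⟩
    N * (∑ (ω i) (codes i) * P) ∎
  where
  R : X → ℕ
  R d = ∏ (λ i → ω i (code i d)) is
  P = ∏ (λ i → ∑ (ω i) (codes i)) is
  fibre : _ → List X
  fibre c = filter (λ d → code i d ≟ c) F
  swap : ∀ a b c → a * (b * c) ≡ b * (a * c)
  swap = solve-∀
  rec : ∀ c → ∑ R (fibre c) ≤ N * P
  rec c = weighted-split _≟_ codes code ω N is (fibre c)
    (λ i∈ d∈ → h (there i∈) (proj₁ (∈-filter⁻ _ d∈)))
    (λ F′ F′⊆ agree → b F′ (⊆-trans F′⊆ (filter-⊆ _ F)) λ where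
      (here refl) d∈ e∈ → trans (on-fibre F′⊆ d∈) (sym (on-fibre F′⊆ e∈))
      (there j∈)  d∈ e∈ → agree j∈ d∈ e∈)
    where
    on-fibre : ∀ {F′ d} → F′ ⊆ fibre c → d ∈ F′ → code i d ≡ c
    on-fibre F′⊆ d∈ = proj₂ (∈-filter⁻ (λ d → code i d ≟ c) {xs = F} (Sub.lookup F′⊆ d∈))

≤ᵇ-true : ∀ {m n} → (m ≤ᵇ n) ≡ true → m ≤ n
≤ᵇ-true e = ≤ᵇ⇒≤ _ _ (Equivalence.from Bool.T-≡ e)

true-≤ᵇ : ∀ {m n} → m ≤ n → (m ≤ᵇ n) ≡ true
true-≤ᵇ h = Equivalence.to Bool.T-≡ (≤⇒≤ᵇ h)

-- Choosing duplicate-free subsets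

Unique-⊆ : ∀ {xs ys : List X} → xs ⊆ ys → Unique ys → Unique xs
Unique-⊆ []         u       = u
Unique-⊆ (y ∷ʳ s)   (_ ∷ u) = Unique-⊆ s u
Unique-⊆ (refl ∷ s) (a ∷ u) = All.tabulate (λ x∈ → All.lookup a (Sub.lookup s x∈)) ∷ Unique-⊆ s u

select : ∀ (p : X → Bool) xs q → q ≤ count p xs →
  ∃ λ Q → length Q ≡ q × Q ⊆ xs × All (λ x → p x ≡ true) Q
select p xs zero h = [] , refl , Sub.minimum xs , []
select p (x ∷ xs) (suc q) h with p x in eq
... | true  = let Q , l , s , a = select p xs q (s≤s⁻¹ h) in x ∷ Q , cong suc l , refl ∷ s , eq ∷ a
... | false = let Q , l , s , a = select p xs (suc q) h in Q , l , x ∷ʳ s , a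

select-prefix : ∀ (xs : List X) q → q ≤ length xs → ∃ λ Q → length Q ≡ q × Q ⊆ xs
select-prefix xs zero h = [] , refl , Sub.minimum xs
select-prefix (x ∷ xs) (suc q) h =
  let Q , l , s = select-prefix xs q (s≤s⁻¹ h) in x ∷ Q , cong suc l , refl ∷ s

module _ (_≟_ : DecidableEquality X) where

  count-without : ∀ (p : X → Bool) u S → Unique S →
    count p S ≤ suc (count (λ s → p s ∧ not (does (s ≟ u))) S)
  count-without p u []      _ = z≤n
  count-without p u (s ∷ S) (a ∷ uS) with s ≟ u
  ... | yes refl = +-mono-≤ (bit≤1 (p s)) (≤-trans (∑-mono S keep) (m≤n+m _ _))
    where
    bit≤1 : ∀ b → bit b ≤ 1
    bit≤1 = bool-≤ bit (λ _ → 1) tt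
    keep : ∀ {x} → x ∈ S → bit (p x) ≤ bit (p x ∧ not (does (x ≟ s)))
    keep {x} x∈ with x ≟ s
    ... | yes refl = contradiction refl (All.lookup a x∈)
    ... | no  _ = bool-≤ bit (λ b → bit (b ∧ true)) tt (p x)
  ... | no _ with p s
  ... | true  = s≤s (count-without p u S uS)
  ... | false = count-without p u S uS

  -- Greedy avoidance: each element of `U` removes at most one candidate, because `S` has no
  -- repetitions. This keeps the constructed paths and cycles simple.
  fresh : ∀ (p : X → Bool) S U → Unique S → length U < count p S →
    ∃ λ s → s ∈ S × p s ≡ true × s ∉ U
  fresh p S [] uS h with select p S 1 h
  ... | s ∷ [] , _ , sub , e ∷ _ = s , Sub.lookup sub (here refl) , e , λ ()
  fresh p S (u ∷ U) uS h
    with s , s∈ , e , s∉ ← fresh (λ s → p s ∧ not (does (s ≟ u))) S U uS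
                             (s≤s⁻¹ (≤-trans h (count-without p u S uS)))
    = s , s∈ , ∧-left e , λ where
        (here refl) → distinct s (∧-right {p s} e)
        (there s∈U) → s∉ s∈U
    where
    distinct : ∀ v → not (does (v ≟ v)) ≡ true → ⊥
    distinct v e with v ≟ v
    distinct v () | yes _
    ... | no v≢v = v≢v refl

count-true : ∀ (xs : List X) → count (λ _ → true) xs ≡ length xs
count-true xs = trans (∑-const 1 xs) (*-identityʳ _)

record Subset (A : List X) (p : X → Bool) (Q : List X) : Set where
  constructor subset
  field
    unique : Unique Q
    inside : ∀ {u} → u ∈ Q → u ∈ A
    holds  : ∀ {u} → u ∈ Q → p u ≡ true
open Subset

weaken : ∀ {A : List X} {p p′ Q} → (∀ {u} → p u ≡ true → p′ u ≡ true) → Subset A p Q → Subset A p′ Q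
weaken h s = subset (unique s) (inside s) (h ∘ holds s)

choose : ∀ {A : List X} → Unique A → ∀ p q → q ≤ count p A → ∃ λ Q → length Q ≡ q × Subset A p Q
choose uA p q h with Q , l , s , a ← select p _ q h
  = Q , l , subset (Unique-⊆ s uA) (Sub.lookup s) (All.lookup a)

-- Digraphs, directed cycles and good orientations

Digraph : Set → Set
Digraph V = V → V → Bool

-- Path d x ys z: the vertices of the path are x ∷ ys, the last one is z.
data Path {V : Set} (d : Digraph V) : V → List V → V → Set where
  []  : ∀ {x} → Path d x [] x
  _∷_ : ∀ {x y ys z} → d x y ≡ true → Path d y ys z → Path d x (y ∷ ys) z

_⧺_ : ∀ {V} {d : Digraph V} {x y z ys zs} → Path d x ys y → Path d y zs z → Path d x (ys ++ zs) z
[]      ⧺ π = π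
(e ∷ ρ) ⧺ π = e ∷ (ρ ⧺ π)

-- A directed cycle is presented as a simple path from `x` to `z` together with the closing arc from
-- `z` to `x`.
Free : {V : Set} → ℕ → List V → Digraph V → Set
Free L A d = ∀ {x ys z} → Path d x ys z → d z x ≡ true →
  Unique (x ∷ ys) → (∀ {v} → v ∈ x ∷ ys → v ∈ A) → length (x ∷ ys) ≡ L → ⊥

inn out : {V : Set} → Digraph V → List V → V → ℕ
inn d Q w = count (λ u → d u w) Q
out d Q w = count (λ u → d w u) Q

K : {V : Set} → Digraph V → ℕ → List V → V → Bool
K d m Q w = (m ≤ᵇ inn d Q w) ∧ (m ≤ᵇ out d Q w)

nbr : {V : Set} → Digraph V → V → V → Bool
nbr d x w = d x w ∨ d w x

-- 31/64 stands for slightly less than one half, 9/16 for substantially more. There are two scales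
-- of expansion: the threshold `2 * k + 3` of `expand₀` is large enough to dodge a whole cycle,
-- while the threshold `q₀` of `expand₁` leaves a subset to which `expand₀` applies again.
record Good {V : Set} (k q₀ q₁ : ℕ) (A : List V) (d : Digraph V) : Set where
  n = length A
  field
    expand₀   : ∀ {Q} → length Q ≡ q₀ → Unique Q → (∀ {u} → u ∈ Q → u ∈ A) →
                n * 31 ≤ count (K d (2 * k + 3) Q) A * 64
    expand₁   : ∀ {Q} → length Q ≡ q₁ → Unique Q → (∀ {u} → u ∈ Q → u ∈ A) →
                n * 31 ≤ count (K d q₀ Q) A * 64
    degree    : ∀ {x} → x ∈ A → n * 31 ≤ count (nbr d x) A * 64
    outdegree : ∀ {x} → x ∈ A → n ≤ count (d x) A * 16
    indegree  : ∀ {x} → x ∈ A → n ≤ count (λ w → d w x) A * 16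
    adjacent  : ∀ {x y} → x ∈ A → y ∈ A → d x y ≡ true → count (λ w → d y w ∧ d w x) A < q₀ →
                n * 9 ≤ count (λ w → nbr d x w ∨ nbr d y w) A * 16

-- The contradiction shared by all density arguments: the sizes add up to at least (j + 1/64) n, yet
-- they exceed j n by at most the total overlap `S`, which is below n/64.
overfull : ∀ j n S s → (n * j) * 64 + n ≤ s * 64 → s ≤ n * j + S → S * 64 < n → ⊥
overfull j n S s h₁ h₂ h₃ = <-irrefl refl (begin-strict
  n * j * 64 + S * 64 <⟨ +-monoʳ-< (n * j * 64) h₃ ⟩
  n * j * 64 + n      ≤⟨ h₁ ⟩
  s * 64              ≤⟨ *-monoˡ-≤ 64 h₂ ⟩
  (n * j + S) * 64    ≡⟨ *-distribʳ-+ 64 (n * j) S ⟩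
  n * j * 64 + S * 64 ∎)

-- p′ is a class of p on which the pattern u ↦ e u w (u ∈ Q) is constant, and Q′ is the
-- support of that pattern.
pigeonhole : ∀ (e : X → X → Bool) (A : List X) t Q p → 2 ^ length Q * t ≤ count p A →
  Σ (X → Bool) λ p′ → Σ (List X) λ Q′ → Q′ ⊆ Q × t ≤ count p′ A ×
    (∀ {w} → p′ w ≡ true → p w ≡ true × count (λ u → e u w) Q ≤ length Q′ ×
                           (∀ {u} → u ∈ Q′ → e u w ≡ true))
pigeonhole e A t [] p h = p , [] , [] , ≤-trans (≤-reflexive (sym (*-identityˡ t))) h ,
  λ pw → pw , z≤n , λ ()
pigeonhole e A t (u ∷ Q) p h with 2 ^ length Q * t ≤? count (λ w → p w ∧ e u w) A
... | yes h₁ with p′ , Q′ , s , c , f ← pigeonhole e A t Q (λ w → p w ∧ e u w) h₁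
    = p′ , u ∷ Q′ , refl ∷ s , c , λ {w} pw →
        let a , b , g = f pw in ∧-left a , in-head (∧-right {p w} a) b , λ where
          (here refl) → ∧-right {p w} a
          (there u∈)  → g u∈
    where
    in-head : ∀ {w l} → e u w ≡ true → count (λ u → e u w) Q ≤ l → bit (e u w) + count (λ u → e u w) Q ≤ suc l
    in-head eq b rewrite eq = s≤s b
... | no h₁ =
    let p′ , Q′ , s , c , f = pigeonhole e A t Q (λ w → p w ∧ not (e u w)) other
    in p′ , Q′ , u ∷ʳ s , c , λ {w} pw →
        let a , b , g = f pw in ∧-left a , not-in-head (∧-right {p w} a) b , g
    where
    not-in-head : ∀ {w l} → not (e u w) ≡ true → count (λ u → e u w) Q ≤ l → bit (e u w) + count (λ u → e u w) Q ≤ l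
    not-in-head {w} eq b with e u w
    ... | false = b
    split : count p A ≤ count (λ w → p w ∧ e u w) A + count (λ w → p w ∧ not (e u w)) A
    split = ≤-trans (∑-mono A (λ {w} _ → pointwise (p w) (e u w))) (≤-reflexive (∑-+ _ _ A))
      where
      pointwise : ∀ a b → bit a ≤ bit (a ∧ b) + bit (a ∧ not b)
      pointwise true  = bool-≤ (λ _ → 1) (λ b → bit b + bit (not b)) tt
      pointwise false b = z≤n
    other : 2 ^ length Q * t ≤ count (λ w → p w ∧ not (e u w)) A
    other = +-cancelˡ-≤ (2 ^ length Q * t) _ _ (begin
      2 ^ length Q * t + 2 ^ length Q * t ≡⟨ double (2 ^ length Q) t ⟩
      2 ^ length (u ∷ Q) * t ≤⟨ h ⟩
      count p A ≤⟨ split ⟩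
      _ ≤⟨ +-monoˡ-≤ _ (<⇒≤ (≰⇒> h₁)) ⟩
      2 ^ length Q * t + _ ∎)
      where
      double : ∀ a t → a * t + a * t ≡ 2 * a * t
      double = solve-∀

-- Good orientations without a directed odd cycle live on bipartite graphs

module Structure {V : Set} (_≟_ : DecidableEquality V) (k q₀ q₁ : ℕ) (A : List V) (uA : Unique A)
  (d : Digraph V) (loopless : ∀ {x y} → x ∈ A → d x y ≡ true → x ≢ y)
  (free : Free (2 * k + 3) A d) (good : Good k q₀ q₁ A d) (m≤q₀ : 2 * k + 3 ≤ q₀)
  (large : (4 * q₁ + (2 ^ q₁ * q₀ + q₀)) * 1024 ≤ length A) where

  open Good good

  -- `m` is the length of the forbidden cycle and also the robustness needed to avoid its other
  -- vertices. `t` bounds the overlap of a set K(Q) with a neighbourhood, and `σ` dominates every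
  -- overlap that occurs below.
  m t σ : ℕ
  m = 2 * k + 3
  t = 2 ^ q₁ * q₀ + q₀
  σ = 4 * q₁ + t

  q₀>0 : 0 < q₀
  q₀>0 = ≤-trans (≤-trans (s≤s z≤n) (m≤n+m 3 (2 * k))) m≤q₀

  q₀≤σ : q₀ ≤ σ
  q₀≤σ = ≤-trans (m≤n+m q₀ (2 ^ q₁ * q₀)) (m≤n+m t (4 * q₁))

  t≤σ : t ≤ σ
  t≤σ = m≤n+m t (4 * q₁)

  4q₁≤σ : 4 * q₁ ≤ σ
  4q₁≤σ = m≤m+n (4 * q₁) t

  small : ∀ {S} → S ≤ σ * 5 → S * 64 < n
  small {S} h = begin-strict
    S * 64       ≤⟨ *-monoˡ-≤ 64 h ⟩
    σ * 5 * 64   ≡⟨ *-assoc σ 5 64 ⟩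
    σ * 320      <⟨ *-monoʳ-< σ ⦃ >-nonZero (≤-trans q₀>0 q₀≤σ) ⦄ {320} {1024} (<ᵇ⇒< _ _ tt) ⟩
    σ * 1024     ≤⟨ large ⟩
    n            ∎

  σ≤ : ∀ i {S} → S ≤ σ * i → i ≤ 5 → S * 64 < n
  σ≤ i h i≤5 = small (≤-trans h (*-monoʳ-≤ σ i≤5))

  q₀≤half : ∀ {c} → n * 31 ≤ c * 64 → q₀ ≤ c
  q₀≤half {c} h = *-cancelʳ-≤ _ _ 64 (begin
    q₀ * 64 ≤⟨ <⇒≤ (σ≤ 1 (≤-trans q₀≤σ (≤-reflexive (sym (*-identityʳ σ)))) (s≤s z≤n)) ⟩
    n       ≡⟨ sym (*-identityʳ n) ⟩
    n * 1   ≤⟨ *-monoʳ-≤ n (s≤s z≤n) ⟩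
    n * 31  ≤⟨ h ⟩
    c * 64  ∎)

  K-in : ∀ {m Q w} → K d m Q w ≡ true → m ≤ inn d Q w
  K-in e = ≤ᵇ-true (∧-left e)

  K-out : ∀ {m Q w} → K d m Q w ≡ true → m ≤ out d Q w
  K-out {m} {Q} {w} e = ≤ᵇ-true (∧-right {m ≤ᵇ inn d Q w} e)

  -- Leaves space for the two new endpoints of a path: `i` is 1 when the first is chosen and 2 when
  -- the second must also avoid the first.
  room : ∀ r (U P : List V) → length P ≡ 2 * r + 1 → length U + 2 * suc r < m → ∀ i → i ≤ 2 →
    i + length (U ++ P) ≤ m
  room r U P lP h i i≤2 = begin
    i + length (U ++ P)          ≡⟨ cong (i +_) (trans (length-++ U) (cong (length U +_) lP)) ⟩
    i + (length U + (2 * r + 1)) ≡⟨ +-comm i _ ⟩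
    length U + (2 * r + 1) + i   ≤⟨ +-monoʳ-≤ _ i≤2 ⟩
    length U + (2 * r + 1) + 2   ≡⟨ rearrange (length U) r ⟩
    suc (length U + 2 * suc r)   ≤⟨ h ⟩
    m                            ∎
    where
    rearrange : ∀ u r → u + (2 * r + 1) + 2 ≡ suc (u + 2 * suc r)
    rearrange = solve-∀

  -- A path of even length 2r is obtained by climbing r levels S, S′ ⊂ K S, S″ ⊂ K S′, …
  -- and descending again, which is possible since every vertex of K S has both
  -- in- and out-neighbours in S.
  bounce : ∀ r S → length S ≡ q₀ → Unique S → (∀ {u} → u ∈ S → u ∈ A) → ∀ U → length U + 2 * r < m →
    ∃ λ x → ∃ λ ys → ∃ λ z → x ∈ S × z ∈ S × Path d x ys z × Unique (x ∷ ys) ×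
      (∀ {v} → v ∈ x ∷ ys → v ∈ A × v ∉ U) × length (x ∷ ys) ≡ 2 * r + 1
  bounce zero S l uS S⊆A U h
    with s , s∈ , _ , s∉ ← fresh _≟_ (λ _ → true) S U uS (begin-strict
      length U         ≡⟨ sym (+-identityʳ _) ⟩
      length U + 0     <⟨ h ⟩
      m                ≤⟨ m≤q₀ ⟩
      q₀               ≡⟨ sym l ⟩
      length S         ≡⟨ sym (count-true S) ⟩
      count (λ _ → true) S ∎)
    = s , [] , s , s∈ , s∈ , [] , [] ∷ [] , (λ { (here refl) → S⊆A s∈ , s∉ }) , refl
  bounce (suc r) S l uS S⊆A U h
    with S′ , l′ , sub ← choose uA (K d m S) q₀ (q₀≤half (expand₀ l uS S⊆A))
    with x , ys , z , x∈ , z∈ , π , uπ , π∉ , lπ ← bounce r S′ l′ (unique sub) (inside sub) U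
           (≤-trans (s≤s (+-monoʳ-≤ (length U) (*-monoʳ-≤ 2 (n≤1+n r)))) h)
    with a , a∈ , a→x , a∉ ← fresh _≟_ (λ u → d u x) S (U ++ x ∷ ys) uS
           (≤-trans (room r U (x ∷ ys) lπ h 1 (s≤s z≤n)) (K-in {m} {S} (holds sub x∈)))
    with b , b∈ , z→b , b∉ ← fresh _≟_ (λ u → d z u) S (a ∷ (U ++ x ∷ ys)) uS
           (≤-trans (room r U (x ∷ ys) lπ h 2 ≤-refl) (K-out {m} {S} (holds sub z∈)))
    = a , (x ∷ ys) ++ b ∷ [] , b , a∈ , b∈ , a→x ∷ (π ⧺ (z→b ∷ [])) ,
      All.tabulate a-new ∷ Unique.++⁺ uπ ([] ∷ []) (λ { (v∈ , here refl) → b∉ (there (∈-++⁺ʳ U v∈)) }) ,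
      avoid , (begin-equality
        suc (length ((x ∷ ys) ++ b ∷ [])) ≡⟨ cong suc (length-++ (x ∷ ys)) ⟩
        suc (length (x ∷ ys) + 1)         ≡⟨ cong (λ i → suc (i + 1)) lπ ⟩
        suc (2 * r + 1 + 1)               ≡⟨ len r ⟩
        2 * suc r + 1                     ∎)
    where
    len : ∀ r → suc (2 * r + 1 + 1) ≡ 2 * suc r + 1
    len = solve-∀
    a-new : ∀ {v} → v ∈ (x ∷ ys) ++ b ∷ [] → a ≢ v
    a-new v∈ refl with ∈-++⁻ (x ∷ ys) v∈
    ... | inj₁ v∈π = a∉ (∈-++⁺ʳ U v∈π)
    ... | inj₂ (here refl) = b∉ (here refl)
    avoid : ∀ {v} → v ∈ a ∷ (x ∷ ys) ++ b ∷ [] → v ∈ A × v ∉ U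
    avoid (here refl) = S⊆A a∈ , a∉ ∘ ∈-++⁺ˡ
    avoid (there v∈) with ∈-++⁻ (x ∷ ys) v∈
    ... | inj₁ v∈π = π∉ v∈π
    ... | inj₂ (here refl) = S⊆A b∈ , b∉ ∘ there ∘ ∈-++⁺ˡ

  two+ : ∀ a → 2 + (a + 1) ≡ a + 3
  two+ = solve-∀

  -- A path of `bounce` inside `Z` has 2k + 1 vertices, so the two vertices supplied by `closing`
  -- complete a cycle of the forbidden length 2k + 3. `U` reserves at most two vertices in advance,
  -- which `bounce` then avoids.
  close-up : ∀ Z U → length Z ≡ q₀ → Subset A (λ _ → true) Z → length U ≤ 2 →
    (∀ {z z′} W → z ∈ Z → z′ ∈ Z → 2 + length W ≤ m → (∀ {u} → u ∈ U → u ∉ W) →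
      ∃ λ c → ∃ λ e → c ∈ A × e ∈ A × d z′ c ≡ true × d c e ≡ true × d e z ≡ true ×
        c ∉ W × e ∉ W × c ≢ e) → ⊥
  close-up Z U lZ sZ lU closing
    with x , ys , z , x∈ , z∈ , π , uπ , π∉ , lπ ← bounce k Z lZ (unique sZ) (inside sZ) U
           (≤-trans (s≤s (+-monoˡ-≤ (2 * k) lU)) (≤-reflexive (+-comm 3 (2 * k))))
    with c , e , c∈ , e∈ , z→c , c→e , e→x , c∉ , e∉ , c≢e ← closing (x ∷ ys) x∈ z∈
           (≤-reflexive (trans (cong (2 +_) lπ) (two+ (2 * k)))) (λ u∈ u∈π → proj₂ (π∉ u∈π) u∈)
    = free (π ⧺ (z→c ∷ c→e ∷ [])) e→x
        (Unique.++⁺ uπ ((c≢e ∷ []) ∷ [] ∷ []) λ where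
          (v∈ , here refl) → c∉ v∈
          (v∈ , there (here refl)) → e∉ v∈)
        inside-A
        (trans (length-++ (x ∷ ys)) (trans (cong (_+ 2) lπ) (+-assoc (2 * k) 1 2)))
    where
    inside-A : ∀ {v} → v ∈ (x ∷ ys) ++ c ∷ e ∷ [] → v ∈ A
    inside-A v∈ with ∈-++⁻ (x ∷ ys) v∈
    ... | inj₁ v∈π = proj₁ (π∉ v∈π)
    ... | inj₂ (here refl) = c∈
    ... | inj₂ (there (here refl)) = e∈

  -- Contrapositive of `close-up`: q₀ vertices, any two of which can be joined back by a path
  -- through two outer vertices, would create a forbidden cycle.
  few : ∀ U p → length U ≤ 2 →
    (∀ {z z′} W → p z ≡ true → p z′ ≡ true → 2 + length W ≤ m → (∀ {u} → u ∈ U → u ∉ W) →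
      ∃ λ c → ∃ λ e → c ∈ A × e ∈ A × d z′ c ≡ true × d c e ≡ true × d e z ≡ true ×
        c ∉ W × e ∉ W × c ≢ e) → count p A < q₀
  few U p lU closing = ≰⇒> λ h →
    let Z , lZ , sZ = choose uA p q₀ h in
    close-up Z U lZ (weaken (λ _ → refl) sZ) lU
      (λ W z∈ z′∈ → closing W (holds sZ z∈) (holds sZ z′∈))

  -- The return path is z′ → x → b → z, where b is an in-neighbour of z in Q and hence an
  -- out-neighbour of x.
  out-K-few : ∀ {x Q j} → x ∈ A → Subset A (d x) Q → m ≤ j → count (λ w → K d j Q w ∧ d w x) A < q₀
  out-K-few {x} {Q} {j} x∈ sQ m≤j = few (x ∷ []) _ (s≤s z≤n) λ {z} {z′} W pz pz′ lW x∉ →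
    let b , b∈ , b→z , b∉ = fresh _≟_ (λ u → d u z) Q (x ∷ W) (unique sQ)
                              (≤-trans lW (≤-trans m≤j (K-in {j} {Q} (∧-left pz))))
    in x , b , x∈ , inside sQ b∈ , ∧-right {K d j Q z′} pz′ , holds sQ b∈ , b→z ,
       x∉ (here refl) , b∉ ∘ there , λ e → b∉ (here (sym e))

  -- The return path is z′ → b → x → z, with b in Q an out-neighbour of z′.
  in-K-few : ∀ {x Q j} → x ∈ A → Subset A (λ u → d u x) Q → m ≤ j →
    count (λ w → K d j Q w ∧ d x w) A < q₀
  in-K-few {x} {Q} {j} x∈ sQ m≤j = few (x ∷ []) _ (s≤s z≤n) λ {z} {z′} W pz pz′ lW x∉ →
    let b , b∈ , z′→b , b∉ = fresh _≟_ (λ u → d z′ u) Q (x ∷ W) (unique sQ)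
                               (≤-trans lW (≤-trans m≤j (K-out {j} {Q} (∧-left pz′))))
    in b , x , inside sQ b∈ , x∈ , z′→b , holds sQ b∈ , ∧-right {K d j Q z} pz ,
       b∉ ∘ there , x∉ (here refl) , λ e → b∉ (here e)

  -- The return path z′ → a → b → z crosses from a in Q to b in W.
  complete-few : ∀ {Q W} → Subset A (λ _ → true) Q → Subset A (λ _ → true) W →
    (∀ {u w} → u ∈ Q → w ∈ W → d u w ≡ true) → count (λ w → K d m Q w ∧ K d m W w) A < q₀
  complete-few {Q} {W} sQ sW Q→W = few [] _ z≤n λ {z} {z′} P pz pz′ lP _ →
    let b , b∈ , b→z , b∉ = fresh _≟_ (λ u → d u z) W P (unique sW)
          (≤-trans (n≤1+n _) (≤-trans lP (K-in {m} {W} (∧-right {K d m Q z} pz))))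
        a , a∈ , z′→a , a∉ = fresh _≟_ (λ u → d z′ u) Q (b ∷ P) (unique sQ)
          (≤-trans lP (K-out {m} {Q} (∧-left pz′)))
    in a , b , inside sQ a∈ , inside sW b∈ , z′→a , Q→W a∈ b∈ , b→z ,
       a∉ ∘ there , b∉ , λ e → a∉ (here e)

  -- The arc itself is the middle of the return path z′ → x → y → z. This supplies the hypothesis of
  -- `adjacent` in `Good`.
  arc-few : ∀ {x y} → x ∈ A → y ∈ A → d x y ≡ true → count (λ w → d y w ∧ d w x) A < q₀
  arc-few {x} {y} x∈ y∈ x→y = few (x ∷ y ∷ []) _ ≤-refl λ {z} {z′} W pz pz′ _ ∉W →
    x , y , x∈ , y∈ , ∧-right {d y z′} pz′ , x→y , ∧-left pz ,
    ∉W (here refl) , ∉W (there (here refl)) , loopless x∈ x→y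

  -- Three almost disjoint sets cannot fit: 31/64 + 31/64 + 4/64 = 66/64 exceeds 65/64.
  three-halves : ∀ p q r → n * 31 ≤ count p A * 64 → n * 31 ≤ count q A * 64 → n ≤ count r A * 16 →
    count (λ x → p x ∧ q x) A ≤ σ → count (λ x → q x ∧ r x) A ≤ σ → count (λ x → p x ∧ r x) A ≤ σ → ⊥
  three-halves p q r hp hq hr pq qr pr =
    overfull 1 n _ _ lower
      (count-linear 1 (p ∷ q ∷ r ∷ [])
        ((λ x → p x ∧ q x) ∷ (λ x → q x ∧ r x) ∷ (λ x → p x ∧ r x) ∷ []) A
        (λ x → pointwise (p x) (q x) (r x)))
      (σ≤ 3 (≤-trans (+-mono-≤ pq (+-mono-≤ qr (+-monoˡ-≤ 0 pr))) (≤-reflexive (triple σ)))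
            (s≤s (s≤s (s≤s z≤n))))
    where
    triple : ∀ σ → σ + (σ + (σ + 0)) ≡ σ * 3
    triple = solve-∀
    sums : ∀ n → n * 1 * 64 + n + n ≡ n * 31 + (n * 31 + n * 4)
    sums = solve-∀
    collect : ∀ a b c → a * 64 + (b * 64 + c * 16 * 4) ≡ (a + (b + (c + 0))) * 64
    collect = solve-∀
    lower : n * 1 * 64 + n ≤ (count p A + (count q A + (count r A + 0))) * 64
    lower = begin
      n * 1 * 64 + n                            ≤⟨ m≤m+n _ n ⟩
      n * 1 * 64 + n + n                        ≡⟨ sums n ⟩
      n * 31 + (n * 31 + n * 4)                 ≤⟨ +-mono-≤ hp (+-mono-≤ hq (*-monoˡ-≤ 4 hr)) ⟩
      count p A * 64 + (count q A * 64 + count r A * 16 * 4)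
        ≡⟨ collect (count p A) (count q A) (count r A) ⟩
      (count p A + (count q A + (count r A + 0))) * 64 ∎
    pointwise : ∀ a b c → bit a + (bit b + (bit c + 0)) ≤ 1 + (bit (a ∧ b) + (bit (b ∧ c) + (bit (a ∧ c) + 0)))
    pointwise false false = bool-≤ _ _ tt
    pointwise false true  = bool-≤ _ _ tt
    pointwise true  false = bool-≤ _ _ tt
    pointwise true  true  = bool-≤ _ _ tt

  private
    member : ∀ {W : List V} {q} → length W ≡ q → 0 < q → ∃ (_∈ W)
    member {[]}    refl ()
    member {w ∷ _} _    _ = w , here refl

  -- Pigeonhole over the 2^q₁ patterns on Q finds q₀ vertices W with a common pattern. Each vertex
  -- of K(Q) sees at least q₀ vertices of Q, so the pattern contains a Q′ of size q₀, complete to W.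
  -- The relation `e` is either the arc relation or its reverse.
  same-side : (e : V → V → Bool) (p : V → Bool) → ∀ {Q} → length Q ≡ q₁ →
    2 ^ q₁ * q₀ ≤ count (λ w → K d q₀ Q w ∧ p w) A →
    (∀ {w} → K d q₀ Q w ≡ true → q₀ ≤ count (λ u → e u w) Q) →
    ∃ λ Q′ → ∃ λ W → length Q′ ≡ q₀ × Q′ ⊆ Q × length W ≡ q₀ × Subset A p W ×
      (∀ {u w} → u ∈ Q′ → w ∈ W → e u w ≡ true)
  same-side e p {Q} lQ h K⇒e
    with p′ , Q⁺ , Q⁺⊆Q , c , f ← pigeonhole e A q₀ Q (λ w → K d q₀ Q w ∧ p w)
           (subst (λ l → 2 ^ l * q₀ ≤ _) (sym lQ) h)
    with W , lW , sW ← choose uA p′ q₀ c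
    with w , w∈ ← member lW q₀>0
    with Q′ , lQ′ , Q′⊆Q⁺ ← select-prefix Q⁺ q₀
           (let a , b , _ = f (holds sW w∈) in ≤-trans (K⇒e (∧-left a)) b)
    = Q′ , W , lQ′ , ⊆-trans Q′⊆Q⁺ Q⁺⊆Q , lW ,
      weaken (λ {u} p′u → ∧-right {K d q₀ Q u} (proj₁ (f p′u))) sW ,
      λ u∈ w∈ → proj₂ (proj₂ (f (holds sW w∈))) (Sub.lookup Q′⊆Q⁺ u∈)

  <⇒≤σ : ∀ {c} → c < q₀ → c ≤ σ
  <⇒≤σ h = ≤-trans (<⇒≤ h) q₀≤σ

  shrink : ∀ {p Q Q′} → Q′ ⊆ Q → Subset A p Q → Subset A p Q′
  shrink Q′⊆Q s = subset (Unique-⊆ Q′⊆Q (unique s)) (inside s ∘ Sub.lookup Q′⊆Q) (holds s ∘ Sub.lookup Q′⊆Q)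

  anything : ∀ {p Q} → Subset A p Q → Subset A (λ _ → true) Q
  anything = weaken (λ _ → refl)

  -- Otherwise N⁺(x) contains a complete pair Q′ → W. Then K(Q′), K(W) and N⁻(x) are pairwise almost
  -- disjoint, against `three-halves`.
  out-own-few : ∀ {x Q} → x ∈ A → length Q ≡ q₁ → Subset A (d x) Q →
    count (λ w → K d q₀ Q w ∧ d x w) A < 2 ^ q₁ * q₀
  out-own-few {x} {Q} x∈ lQ sQ = ≰⇒> λ h →
    let Q′ , W , lQ′ , Q′⊆Q , lW , sW , Q′→W = same-side d (d x) lQ h (K-in {q₀} {Q})
        sQ′ = shrink Q′⊆Q sQ
    in three-halves (K d m Q′) (K d m W) (λ w → d w x)
         (expand₀ lQ′ (unique sQ′) (inside sQ′)) (expand₀ lW (unique sW) (inside sW)) (indegree x∈)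
         (<⇒≤σ (complete-few (anything sQ′) (anything sW) Q′→W))
         (<⇒≤σ (out-K-few x∈ sW (≤-refl {m}))) (<⇒≤σ (out-K-few x∈ sQ′ (≤-refl {m})))

  -- The same argument with all arcs reversed: the complete pair W → Q′ lies in N⁻(x), and the third
  -- set is N⁺(x).
  in-own-few : ∀ {x Q} → x ∈ A → length Q ≡ q₁ → Subset A (λ u → d u x) Q →
    count (λ w → K d q₀ Q w ∧ d w x) A < 2 ^ q₁ * q₀
  in-own-few {x} {Q} x∈ lQ sQ = ≰⇒> λ h →
    let Q′ , W , lQ′ , Q′⊆Q , lW , sW , W→Q′ =
          same-side (λ u w → d w u) (λ u → d u x) lQ h (K-out {q₀} {Q})
        sQ′ = shrink Q′⊆Q sQ
    in three-halves (K d m W) (K d m Q′) (d x)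
         (expand₀ lW (unique sW) (inside sW)) (expand₀ lQ′ (unique sQ′) (inside sQ′)) (outdegree x∈)
         (<⇒≤σ (complete-few (anything sW) (anything sQ′) (λ w∈ u∈ → W→Q′ u∈ w∈)))
         (<⇒≤σ (in-K-few x∈ sQ′ (≤-refl {m}))) (<⇒≤σ (in-K-few x∈ sW (≤-refl {m})))

  count-∧∨ : ∀ (p q r : V → Bool) {a b} → count (λ w → p w ∧ q w) A < a → count (λ w → p w ∧ r w) A < b →
    count (λ w → p w ∧ (q w ∨ r w)) A ≤ a + b
  count-∧∨ p q r ha hb = begin
    count (λ w → p w ∧ (q w ∨ r w)) A
      ≤⟨ ∑-mono A (λ {w} _ → pointwise (p w) (q w) (r w)) ⟩
    ∑ (λ w → bit (p w ∧ q w) + bit (p w ∧ r w)) A ≡⟨ ∑-+ _ _ A ⟩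
    count (λ w → p w ∧ q w) A + count (λ w → p w ∧ r w) A ≤⟨ +-mono-≤ (<⇒≤ ha) (<⇒≤ hb) ⟩
    _ ∎
    where
    pointwise : ∀ a b c → bit (a ∧ (b ∨ c)) ≤ bit (a ∧ b) + bit (a ∧ c)
    pointwise false b c = z≤n
    pointwise true true c = s≤s z≤n
    pointwise true false c = ≤-refl

  out-N-few : ∀ {x Q} → x ∈ A → length Q ≡ q₁ → Subset A (d x) Q →
    count (λ w → K d q₀ Q w ∧ nbr d x w) A ≤ t
  out-N-few {x} {Q} x∈ lQ sQ = count-∧∨ (K d q₀ Q) (d x) (λ w → d w x)
    (out-own-few x∈ lQ sQ) (out-K-few x∈ sQ m≤q₀)

  in-N-few : ∀ {x Q} → x ∈ A → length Q ≡ q₁ → Subset A (λ u → d u x) Q →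
    count (λ w → K d q₀ Q w ∧ nbr d x w) A ≤ t
  in-N-few {x} {Q} x∈ lQ sQ = ≤-trans (count-∧∨ (K d q₀ Q) (d x) (λ w → d w x)
    (in-K-few x∈ sQ m≤q₀) (in-own-few x∈ lQ sQ)) (≤-reflexive (+-comm q₀ _))

  -- A set of almost half of the vertices that nearly misses both neighbourhoods. As the degrees are
  -- about n/2, it forces N(x) and N(y) to be nearly the same set.
  Separator : V → V → Set
  Separator x y = ∃ λ S → n * 31 ≤ count S A * 64 ×
    count (λ w → S w ∧ nbr d x w) A ≤ t × count (λ w → S w ∧ nbr d y w) A ≤ t

  NSubset : V → List V → Set
  NSubset x Q = Subset A (d x) Q ⊎ Subset A (λ u → d u x) Q

  N-few : ∀ {x Q} → x ∈ A → length Q ≡ q₁ → NSubset x Q → count (λ w → K d q₀ Q w ∧ nbr d x w) A ≤ t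
  N-few x∈ lQ (inj₁ s) = out-N-few x∈ lQ s
  N-few x∈ lQ (inj₂ s) = in-N-few x∈ lQ s

  separator : ∀ {x y Q} → x ∈ A → y ∈ A → length Q ≡ q₁ → Subset A (λ _ → true) Q →
    NSubset x Q → NSubset y Q → Separator x y
  separator {Q = Q} x∈ y∈ lQ s sx sy =
    K d q₀ Q , expand₁ lQ (unique s) (inside s) , N-few x∈ lQ sx , N-few y∈ lQ sy

  -- Each common neighbour has one of four in/out types, so some type occurs q₁ times; for a set Q
  -- of that type, K(Q) is the separator.
  common-nbrs : ∀ {x y} → x ∈ A → y ∈ A → 4 * q₁ ≤ count (λ w → nbr d x w ∧ nbr d y w) A → Separator x y
  common-nbrs {x} {y} x∈ y∈ h with q₁ ≤? count (λ w → d x w ∧ d y w) A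
  ... | yes c = let Q , lQ , s = choose uA _ q₁ c in separator x∈ y∈ lQ (anything s)
                  (inj₁ (weaken ∧-left s)) (inj₁ (weaken (λ {u} → ∧-right {d x u}) s))
  ... | no c₁ with q₁ ≤? count (λ w → d x w ∧ d w y) A
  ... | yes c = let Q , lQ , s = choose uA _ q₁ c in separator x∈ y∈ lQ (anything s)
                  (inj₁ (weaken ∧-left s)) (inj₂ (weaken (λ {u} → ∧-right {d x u}) s))
  ... | no c₂ with q₁ ≤? count (λ w → d w x ∧ d y w) A
  ... | yes c = let Q , lQ , s = choose uA _ q₁ c in separator x∈ y∈ lQ (anything s)
                  (inj₂ (weaken ∧-left s)) (inj₁ (weaken (λ {u} → ∧-right {d u x}) s))
  ... | no c₃ with q₁ ≤? count (λ w → d w x ∧ d w y) A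
  ... | yes c = let Q , lQ , s = choose uA _ q₁ c in separator x∈ y∈ lQ (anything s)
                  (inj₂ (weaken ∧-left s)) (inj₂ (weaken (λ {u} → ∧-right {d u x}) s))
  ... | no c₄ = ⊥-elim (<-irrefl refl (begin-strict
    4 * q₁ ≤⟨ h ⟩
    count (λ w → nbr d x w ∧ nbr d y w) A ≡⟨ sym (+-identityʳ _) ⟩
    count (λ w → nbr d x w ∧ nbr d y w) A + 0
      ≤⟨ count-linear 0 ((λ w → nbr d x w ∧ nbr d y w) ∷ [])
           ((λ w → d x w ∧ d y w) ∷ (λ w → d x w ∧ d w y) ∷ (λ w → d w x ∧ d y w) ∷ (λ w → d w x ∧ d w y) ∷ [])
           A (λ w → pointwise (d x w) (d w x) (d y w) (d w y)) ⟩
    n * 0 + four ≡⟨ cong (_+ four) (*-zeroʳ n) ⟩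
    four
      <⟨ +-mono-<-≤ (≰⇒> c₁) (+-mono-≤ (<⇒≤ (≰⇒> c₂)) (+-mono-≤ (<⇒≤ (≰⇒> c₃))
           (+-monoˡ-≤ 0 (<⇒≤ (≰⇒> c₄))))) ⟩
    4 * q₁ ∎))
    where
    four = count (λ w → d x w ∧ d y w) A + (count (λ w → d x w ∧ d w y) A +
      (count (λ w → d w x ∧ d y w) A + (count (λ w → d w x ∧ d w y) A + 0)))
    pointwise : ∀ a b c e → bit ((a ∨ b) ∧ (c ∨ e)) + 0 ≤
      bit (a ∧ c) + (bit (a ∧ e) + (bit (b ∧ c) + (bit (b ∧ e) + 0)))
    pointwise false false c e = z≤n
    pointwise false true  false = bool-≤ _ _ tt
    pointwise false true  true  = bool-≤ _ _ tt
    pointwise true  b true  e = s≤s z≤n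
    pointwise true  b false true  = s≤s z≤n
    pointwise true  b false false = z≤n

  -- A separator of density 31/64 nearly misses the union of the two neighbourhoods, which has
  -- density at least 36/64; together they exceed 65/64.
  arc-N-few : ∀ {x y} → x ∈ A → y ∈ A → d x y ≡ true → count (λ w → nbr d x w ∧ nbr d y w) A < 4 * q₁
  arc-N-few {x} {y} x∈ y∈ x→y = ≰⇒> λ h →
    let S , big , Sx , Sy = common-nbrs x∈ y∈ h
        union = adjacent x∈ y∈ x→y (arc-few x∈ y∈ x→y)
    in overfull 1 n _ _ (lower (count S A) (count (λ w → nbr d x w ∨ nbr d y w) A) big union)
         (count-linear 1 (S ∷ (λ w → nbr d x w ∨ nbr d y w) ∷ [])
           ((λ w → S w ∧ nbr d x w) ∷ (λ w → S w ∧ nbr d y w) ∷ []) A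
           (λ w → pointwise (S w) (nbr d x w) (nbr d y w)))
         (σ≤ 2 (≤-trans (+-mono-≤ (≤-trans Sx t≤σ) (+-monoˡ-≤ 0 (≤-trans Sy t≤σ))) (≤-reflexive (twice σ)))
           (s≤s (s≤s z≤n)))
    where
    twice : ∀ σ → σ + (σ + 0) ≡ σ * 2
    twice = solve-∀
    pointwise : ∀ a b c → bit a + (bit (b ∨ c) + 0) ≤ 1 + (bit (a ∧ b) + (bit (a ∧ c) + 0))
    pointwise false false = bool-≤ _ _ tt
    pointwise false true  = bool-≤ _ _ tt
    pointwise true  false = bool-≤ _ _ tt
    pointwise true  true  = bool-≤ _ _ tt
    sums : ∀ n → n * 1 * 64 + n + (n + n) ≡ n * 31 + n * 9 * 4
    sums = solve-∀
    collect : ∀ a b → a * 64 + b * 16 * 4 ≡ (a + (b + 0)) * 64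
    collect = solve-∀
    lower : ∀ a b → n * 31 ≤ a * 64 → n * 9 ≤ b * 16 → n * 1 * 64 + n ≤ (a + (b + 0)) * 64
    lower a b ha hb = begin
      n * 1 * 64 + n             ≤⟨ m≤m+n _ (n + n) ⟩
      n * 1 * 64 + n + (n + n)   ≡⟨ sums n ⟩
      n * 31 + n * 9 * 4         ≤⟨ +-mono-≤ ha (*-monoˡ-≤ 4 hb) ⟩
      a * 64 + b * 16 * 4        ≡⟨ collect a b ⟩
      (a + (b + 0)) * 64         ∎

  -- An independent set of the pentagon has at most two vertices, so apart from overlaps each point
  -- lies in at most two of the sets. But 5 · 31/64 = 155/64 exceeds 2 + 1/64. The sets may repeat.
  five-cycle : ∀ p₁ p₂ p₃ p₄ p₅ →
    n * 31 ≤ count p₁ A * 64 → n * 31 ≤ count p₂ A * 64 → n * 31 ≤ count p₃ A * 64 →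
    n * 31 ≤ count p₄ A * 64 → n * 31 ≤ count p₅ A * 64 →
    count (λ x → p₁ x ∧ p₂ x) A ≤ σ → count (λ x → p₂ x ∧ p₃ x) A ≤ σ → count (λ x → p₃ x ∧ p₄ x) A ≤ σ →
    count (λ x → p₄ x ∧ p₅ x) A ≤ σ → count (λ x → p₅ x ∧ p₁ x) A ≤ σ → ⊥
  five-cycle p₁ p₂ p₃ p₄ p₅ h₁ h₂ h₃ h₄ h₅ s₁ s₂ s₃ s₄ s₅ =
    overfull 2 n _ _ (lower (count p₁ A) (count p₂ A) (count p₃ A) (count p₄ A) (count p₅ A) h₁ h₂ h₃ h₄ h₅)
      (count-linear 2 (p₁ ∷ p₂ ∷ p₃ ∷ p₄ ∷ p₅ ∷ [])
        ((λ x → p₁ x ∧ p₂ x) ∷ (λ x → p₂ x ∧ p₃ x) ∷ (λ x → p₃ x ∧ p₄ x) ∷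
         (λ x → p₄ x ∧ p₅ x) ∷ (λ x → p₅ x ∧ p₁ x) ∷ []) A
        (λ x → pointwise (p₁ x) (p₂ x) (p₃ x) (p₄ x) (p₅ x)))
      (σ≤ 5 (≤-trans (+-mono-≤ s₁ (+-mono-≤ s₂ (+-mono-≤ s₃ (+-mono-≤ s₄ (+-monoˡ-≤ 0 s₅)))))
               (≤-reflexive (quintuple σ))) ≤-refl)
    where
    quintuple : ∀ σ → σ + (σ + (σ + (σ + (σ + 0)))) ≡ σ * 5
    quintuple = solve-∀
    pointwise : ∀ a b c e f → bit a + (bit b + (bit c + (bit e + (bit f + 0)))) ≤
      2 + (bit (a ∧ b) + (bit (b ∧ c) + (bit (c ∧ e) + (bit (e ∧ f) + (bit (f ∧ a) + 0)))))
    pointwise false false false false = bool-≤ _ _ tt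
    pointwise false false false true  = bool-≤ _ _ tt
    pointwise false false true  false = bool-≤ _ _ tt
    pointwise false false true  true  = bool-≤ _ _ tt
    pointwise false true  false false = bool-≤ _ _ tt
    pointwise false true  false true  = bool-≤ _ _ tt
    pointwise false true  true  false = bool-≤ _ _ tt
    pointwise false true  true  true  = bool-≤ _ _ tt
    pointwise true  false false false = bool-≤ _ _ tt
    pointwise true  false false true  = bool-≤ _ _ tt
    pointwise true  false true  false = bool-≤ _ _ tt
    pointwise true  false true  true  = bool-≤ _ _ tt
    pointwise true  true  false false = bool-≤ _ _ tt
    pointwise true  true  false true  = bool-≤ _ _ tt
    pointwise true  true  true  false = bool-≤ _ _ tt
    pointwise true  true  true  true  = bool-≤ _ _ tt
    sums : ∀ n → n * 2 * 64 + n + n * 26 ≡ n * 31 + (n * 31 + (n * 31 + (n * 31 + n * 31)))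
    sums = solve-∀
    collect : ∀ a b c e f → a * 64 + (b * 64 + (c * 64 + (e * 64 + f * 64))) ≡ (a + (b + (c + (e + (f + 0))))) * 64
    collect = solve-∀
    lower : ∀ a b c e f → n * 31 ≤ a * 64 → n * 31 ≤ b * 64 → n * 31 ≤ c * 64 → n * 31 ≤ e * 64 →
      n * 31 ≤ f * 64 → n * 2 * 64 + n ≤ (a + (b + (c + (e + (f + 0))))) * 64
    lower a b c e f ha hb hc he hf = begin
      n * 2 * 64 + n             ≤⟨ m≤m+n _ (n * 26) ⟩
      n * 2 * 64 + n + n * 26    ≡⟨ sums n ⟩
      n * 31 + (n * 31 + (n * 31 + (n * 31 + n * 31)))
        ≤⟨ +-mono-≤ ha (+-mono-≤ hb (+-mono-≤ hc (+-mono-≤ he hf))) ⟩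
      a * 64 + (b * 64 + (c * 64 + (e * 64 + f * 64))) ≡⟨ collect a b c e f ⟩
      (a + (b + (c + (e + (f + 0))))) * 64 ∎

  ∧-swap : ∀ (p q : V → Bool) {s} → count (λ x → p x ∧ q x) A ≤ s → count (λ x → q x ∧ p x) A ≤ s
  ∧-swap p q h = ≤-trans (∑-mono A (λ {x} _ → ≤-reflexive (cong bit (Bool.∧-comm (q x) (p x))))) h

  colouring : ∃ λ (c : V → Bool) → ∀ {x y} → x ∈ A → y ∈ A → d x y ≡ true → c x ≢ c y
  colouring with a , a∈ ← member {A} {n} refl (≤-trans (s≤s z≤n) (small {0} z≤n))
    = c , alternate
    where
    c : V → Bool
    -- The colour records whether N(x) is close to the neighbourhood of the reference vertex `a` or
    -- almost disjoint from it.
    c x = 4 * q₁ ≤ᵇ count (λ w → nbr d x w ∧ nbr d a w) A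
    c-false : ∀ {x} → c x ≡ false → count (λ w → nbr d x w ∧ nbr d a w) A ≤ σ
    c-false {x} e = ≤-trans (<⇒≤ (≰⇒> λ h → contradiction (trans (sym (true-≤ᵇ h)) e) λ ())) 4q₁≤σ
    alternate : ∀ {x y} → x ∈ A → y ∈ A → d x y ≡ true → c x ≢ c y
    alternate {x} {y} x∈ y∈ x→y cx≡cy with c x in ex
    -- N(x), N(a) and N(y) are pairwise almost disjoint; this triangle is traversed as the closed
    -- walk x, a, y, x, y of length five.
    ... | false = five-cycle (nbr d x) (nbr d a) (nbr d y) (nbr d x) (nbr d y)
            (degree x∈) (degree a∈) (degree y∈) (degree x∈) (degree y∈)
            (c-false ex) (∧-swap (nbr d y) (nbr d a) (c-false (sym cx≡cy))) (∧-swap (nbr d x) (nbr d y) xy) xy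
            (∧-swap (nbr d x) (nbr d y) xy)
      where xy = ≤-trans (<⇒≤ (arc-N-few x∈ y∈ x→y)) 4q₁≤σ
    -- Two separators close the pentagon N(x), S, N(a), S′, N(y), whose last side comes from the arc
    -- x → y.
    ... | true with S , S-big , Sx , Sa ← common-nbrs x∈ a∈ (≤ᵇ-true ex)
               with S′ , S′-big , S′y , S′a ← common-nbrs y∈ a∈ (≤ᵇ-true (sym cx≡cy))
      = five-cycle (nbr d x) S (nbr d a) S′ (nbr d y)
          (degree x∈) S-big (degree a∈) S′-big (degree y∈)
          (∧-swap S (nbr d x) (≤-trans Sx t≤σ)) (≤-trans Sa t≤σ) (∧-swap S′ (nbr d a) (≤-trans S′a t≤σ))
          (≤-trans S′y t≤σ)
          (∧-swap (nbr d x) (nbr d y) (≤-trans (<⇒≤ (arc-N-few x∈ y∈ x→y)) 4q₁≤σ))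

-- Families of orientations

AllPairs-⊆ : ∀ {R : X → X → Set} {xs ys} → xs ⊆ ys → AllPairs R ys → AllPairs R xs
AllPairs-⊆ []         u       = u
AllPairs-⊆ (y ∷ʳ s)   (_ ∷ u) = AllPairs-⊆ s u
AllPairs-⊆ (refl ∷ s) (a ∷ u) = All.tabulate (λ x∈ → All.lookup a (Sub.lookup s x∈)) ∷ AllPairs-⊆ s u

length-cartesianProduct : ∀ {Y : Set} (xs : List X) (ys : List Y) →
  length (cartesianProduct xs ys) ≡ length xs * length ys
length-cartesianProduct []       ys = refl
length-cartesianProduct (x ∷ xs) ys = trans (length-++ (map (x ,_) ys))
  (cong₂ _+_ (length-map (x ,_) ys) (length-cartesianProduct xs ys))

4ab≤[a+b]² : ∀ a b → a * b * 4 ≤ (a + b) * (a + b)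
4ab≤[a+b]² a b with ≤-total a b
... | inj₁ a≤b with x , refl ← m≤n⇒∃[o]m+o≡n a≤b = ≤-trans (m≤m+n _ (x * x)) (≤-reflexive (square a x))
  where
  square : ∀ a x → a * (a + x) * 4 + x * x ≡ (a + (a + x)) * (a + (a + x))
  square = solve-∀
... | inj₂ b≤a with x , refl ← m≤n⇒∃[o]m+o≡n b≤a = ≤-trans (m≤m+n _ (x * x)) (≤-reflexive (square b x))
  where
  square : ∀ a x → (a + x) * a * 4 + x * x ≡ (a + x + a) * (a + x + a)
  square = solve-∀

ab≤[a+b]²/4 : ∀ a b → a * b ≤ ((a + b) * (a + b)) / 4
ab≤[a+b]²/4 a b = begin
  a * b                     ≡⟨ sym (m*n/n≡m (a * b) 4) ⟩
  a * b * 4 / 4             ≤⟨ /-monoˡ-≤ 4 (4ab≤[a+b]² a b) ⟩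
  ((a + b) * (a + b)) / 4   ∎

module Counting {V : Set} (_≟_ : DecidableEquality V) (adj : V → V → Bool)
  (adj-sym : ∀ u v → adj u v ≡ adj v u) (L : ℕ) where


  -- One equation says that arcs lie on edges, that every edge carries an arc, and that no edge
  -- carries both.
  Oriented : List V → Digraph V → Set
  Oriented A d = ∀ {u w} → u ∈ A → w ∈ A → d w u ≡ adj u w ∧ not (d u w)

  Agree : List V → Digraph V → Digraph V → Set
  Agree A d e = ∀ {u w} → u ∈ A → w ∈ A → d u w ≡ e u w

  -- Digraphs remain functions on all of `V`, but only their values on `A` matter. Deleting vertices
  -- thus changes `A` and leaves the list `F` as it is.
  record Family (A : List V) (F : List (Digraph V)) : Set where
    constructor family
    field
      oriented : ∀ {d} → d ∈ F → Oriented A d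
      free     : ∀ {d} → d ∈ F → Free L A d
      distinct : AllPairs (λ d e → ¬ Agree A d e) F
  open Family

  Bounded : List V → ℕ → Set
  Bounded A N = ∀ {F} → Family A F → length F ≤ N

  subfamily : ∀ {A F F′} → F′ ⊆ F → Family A F → Family A F′
  subfamily s φ = family (oriented φ ∘ Sub.lookup s) (free φ ∘ Sub.lookup s) (AllPairs-⊆ s (distinct φ))

  _∖_ : List V → List V → List V
  A ∖ []      = A
  A ∖ (v ∷ T) = filter (λ w → ¬? (w ≟ v)) A ∖ T

  ∖⊆ : ∀ A T → A ∖ T ⊆ A
  ∖⊆ A []      = ⊆-refl
  ∖⊆ A (v ∷ T) = ⊆-trans (∖⊆ _ T) (filter-⊆ _ A)

  ∈-∖ : ∀ A T {w} → w ∈ A → w ∈ T ⊎ w ∈ A ∖ T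
  ∈-∖ A []      w∈ = inj₂ w∈
  ∈-∖ A (v ∷ T) {w} w∈ with w ≟ v
  ... | yes refl = inj₁ (here refl)
  ... | no w≢v with ∈-∖ _ T (∈-filter⁺ (λ w → ¬? (w ≟ v)) w∈ w≢v)
  ... | inj₁ w∈T = inj₁ (there w∈T)
  ... | inj₂ w∈∖ = inj₂ w∈∖

  length-remove : ∀ A {v} → Unique A → v ∈ A → suc (length (filter (λ w → ¬? (w ≟ v)) A)) ≡ length A
  length-remove (v ∷ A) (a ∷ uA) (here refl)
    rewrite filter-reject (λ w → ¬? (w ≟ v)) {v} {A} (λ v≢v → v≢v refl)
          | filter-all (λ w → ¬? (w ≟ v)) {A} (All.map (λ v≢w w≡v → v≢w (sym w≡v)) a) = refl
  length-remove (w ∷ A) {v} (a ∷ uA) (there v∈)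
    rewrite filter-accept (λ w → ¬? (w ≟ v)) {w} {A} (All.lookup a v∈) = cong suc (length-remove A uA v∈)

  length-∖ : ∀ A T → Unique A → Unique T → (∀ {u} → u ∈ T → u ∈ A) → length (A ∖ T) + length T ≡ length A
  length-∖ A []      uA uT T⊆A = +-identityʳ _
  length-∖ A (v ∷ T) uA (a ∷ uT) T⊆A = begin-equality
    length (A ∖ (v ∷ T)) + suc (length T)      ≡⟨ +-suc _ _ ⟩
    suc (length (A ∖ (v ∷ T)) + length T)      ≡⟨ cong suc (length-∖ _ T (Unique.filter⁺ _ uA) uT still-in) ⟩
    suc (length (filter (λ w → ¬? (w ≟ v)) A)) ≡⟨ length-remove A uA (T⊆A (here refl)) ⟩
    length A ∎
    where
    still-in : ∀ {u} → u ∈ T → u ∈ filter (λ w → ¬? (w ≟ v)) A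
    still-in u∈ = ∈-filter⁺ (λ w → ¬? (w ≟ v)) (T⊆A (there u∈)) (λ u≡v → All.lookup a u∈ (sym u≡v))

  arc⇒adj : ∀ {A d u w} → Oriented A d → u ∈ A → w ∈ A → d u w ≡ true → adj u w ≡ true
  arc⇒adj {u = u} {w} o u∈ w∈ e = trans (adj-sym u w) (∧-left (trans (sym (o w∈ u∈)) e))

  code : List V → V → Digraph V → List Bool
  code T w d = map (λ u → d u w) T

  -- Patterns compatible with `adj`: an edge allows two bits, a non-edge only `false`. This saving
  -- on non-edges is what makes low degrees rare.
  codes : List V → V → List (List Bool)
  codes []      w = [] ∷ []
  codes (u ∷ T) w = map (false ∷_) (codes T w) ++ (if adj u w then map (true ∷_) (codes T w) else [])

  code∈codes : ∀ {A d w} → Oriented A d → w ∈ A → ∀ T → (∀ {u} → u ∈ T → u ∈ A) → code T w d ∈ codes T w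
  code∈codes o w∈ [] T⊆A = here refl
  code∈codes {A} {d} {w} o w∈ (u ∷ T) T⊆A with d u w in eq
  ... | false = ∈-++⁺ˡ (∈-map⁺ (false ∷_) (code∈codes o w∈ T (T⊆A ∘ there)))
  ... | true rewrite arc⇒adj o (T⊆A (here refl)) w∈ eq =
    ∈-++⁺ʳ (map (false ∷_) (codes T w)) (∈-map⁺ (true ∷_) (code∈codes o w∈ T (T⊆A ∘ there)))

  code-injective : ∀ T w d e {u} → code T w d ≡ code T w e → u ∈ T → d u w ≡ e u w
  code-injective (u ∷ T) w d e eq (here refl) = ∷-injectiveˡ eq
  code-injective (u ∷ T) w d e eq (there u∈)  = code-injective T w d e (∷-injectiveʳ eq) u∈

  agree-≤1 : ∀ {A F} → Family A F → (∀ {d e} → d ∈ F → e ∈ F → Agree A d e) → length F ≤ 1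
  agree-≤1 {F = []}        φ h = z≤n
  agree-≤1 {F = d ∷ []}    φ h = s≤s z≤n
  agree-≤1 {F = d ∷ e ∷ F} (family _ _ ((¬a ∷ _) ∷ _)) h =
    ⊥-elim (¬a (h (here refl) (there (here refl))))

  -- Members with equal codes agree on every arc that meets `T`, in either direction by `oriented`;
  -- so any difference between them shows on the remaining vertices.
  restrict : ∀ {A T F} → (∀ {u} → u ∈ T → u ∈ A) → Family A F →
    (∀ {w d e} → w ∈ A → d ∈ F → e ∈ F → code T w d ≡ code T w e) → Family (A ∖ T) F
  restrict {A} {T} {F} T⊆A φ same = family
    (λ d∈ u∈ w∈ → oriented φ d∈ (Sub.lookup (∖⊆ A T) u∈) (Sub.lookup (∖⊆ A T) w∈))
    (λ d∈ π e u π⊆ → free φ d∈ π e u (Sub.lookup (∖⊆ A T) ∘ π⊆))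
    (distinct′ (distinct φ) (λ d∈ → d∈))
    where
    extend : ∀ {d e} → d ∈ F → e ∈ F → Agree (A ∖ T) d e → Agree A d e
    extend {d} {e} d∈ e∈ agree {u} {w} u∈ w∈ with ∈-∖ A T u∈ | ∈-∖ A T w∈
    ... | inj₁ u∈T | _        = code-injective T w d e (same w∈ d∈ e∈) u∈T
    ... | inj₂ _   | inj₁ w∈T = trans (oriented φ d∈ w∈ u∈)
            (trans (cong (λ b → adj w u ∧ not b) (code-injective T u d e (same u∈ d∈ e∈) w∈T))
                   (sym (oriented φ e∈ w∈ u∈)))
    ... | inj₂ u∈′ | inj₂ w∈′ = agree u∈′ w∈′
    distinct′ : ∀ {F′} → AllPairs (λ d e → ¬ Agree A d e) F′ → (∀ {d} → d ∈ F′ → d ∈ F) →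
      AllPairs (λ d e → ¬ Agree (A ∖ T) d e) F′
    distinct′ []      _ = []
    distinct′ (a ∷ p) s = All.tabulate (λ e∈ agree → All.lookup a e∈ (extend (s (here refl)) (s (there e∈)) agree))
                          ∷ distinct′ p (s ∘ there)

  -- A Markov inequality: every member contributes weight at least `Λ`, while `weighted-split`
  -- bounds the total. Once all codes are fixed, at most `N` members remain by `restrict`.
  class-bound : ∀ {A T F N} (ω : V → List Bool → ℕ) Λ S →
    (∀ {u} → u ∈ T → u ∈ A) → Bounded (A ∖ T) N → Family A F →
    (∀ {d} → d ∈ F → Λ ≤ ∏ (λ w → ω w (code T w d)) A) →
    (∀ {w} → w ∈ A → ∑ (ω w) (codes T w) ≤ S) →
    length F * Λ ≤ N * S ^ length A
  class-bound {A} {T} {F} {N} ω Λ S T⊆A bound φ hΛ hS = begin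
    length F * Λ                                 ≡⟨ sym (∑-const Λ F) ⟩
    ∑ (λ _ → Λ) F                                ≤⟨ ∑-mono F hΛ ⟩
    ∑ (λ d → ∏ (λ w → ω w (code T w d)) A) F
      ≤⟨ weighted-split (List.≡-dec Bool._≟_) (codes T) (code T) ω N A F
           (λ w∈ d∈ → code∈codes (oriented φ d∈) w∈ T T⊆A)
           (λ F′ F′⊆F agree → bound (restrict T⊆A (subfamily F′⊆F φ) agree)) ⟩
    N * ∏ (λ w → ∑ (ω w) (codes T w)) A          ≤⟨ *-monoʳ-≤ N (∏-≤-^ S A hS) ⟩
    N * S ^ length A                             ∎

  -- `weighted-split` with unit weights: each pair in `P` is an index with two possible codes.
  pairs-bound : ∀ {A F} (P : List (V × V)) → Family A F →
    (∀ {d e} → d ∈ F → e ∈ F → (∀ {u w} → (u , w) ∈ P → d u w ≡ e u w) → Agree A d e) →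
    length F ≤ 2 ^ length P
  pairs-bound {A} {F} P φ h = begin
    length F                        ≡⟨ sym (*-identityʳ _) ⟩
    length F * 1                    ≡⟨ sym (∑-const 1 F) ⟩
    ∑ (λ _ → 1) F                   ≤⟨ ∑-mono F (λ _ → ≤-reflexive (sym (trans (∏-const 1 P) (^-zeroˡ (length P))))) ⟩
    ∑ (λ _ → ∏ (λ _ → 1) P) F
      ≤⟨ weighted-split Bool._≟_ (λ _ → true ∷ false ∷ []) (λ (u , w) d → d u w) (λ _ _ → 1) 1 P F
           (λ {(u , w)} {d} _ _ → any-bit (d u w))
           (λ F′ s agree → agree-≤1 (subfamily s φ) (λ d∈ e∈ →
              h (Sub.lookup s d∈) (Sub.lookup s e∈) (λ p∈ → agree p∈ d∈ e∈))) ⟩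
    1 * ∏ (λ _ → 2) P               ≡⟨ trans (*-identityˡ _) (∏-const 2 P) ⟩
    2 ^ length P                    ∎
    where
    any-bit : ∀ b → b ∈ true ∷ false ∷ []
    any-bit true  = here refl
    any-bit false = there (here refl)

  trivial-bound : ∀ A → Bounded A (2 ^ (length A * length A))
  trivial-bound A φ = ≤-trans
    (pairs-bound (cartesianProduct A A) φ (λ _ _ h u∈ w∈ → h (∈-cartesianProduct⁺ u∈ w∈)))
    (≤-reflexive (cong (2 ^_) (length-cartesianProduct A A)))

  bipartite-bound : ∀ {A} (c : V → Bool) →
    (∀ {u w} → u ∈ A → w ∈ A → adj u w ≡ true → c u ≢ c w) → Bounded A (2 ^ ((length A * length A) / 4))
  bipartite-bound {A} c proper {F} φ = begin
    length F                          ≤⟨ pairs-bound (cartesianProduct A₁ A₂) φ agree ⟩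
    2 ^ length (cartesianProduct A₁ A₂) ≡⟨ cong (2 ^_) (length-cartesianProduct A₁ A₂) ⟩
    2 ^ (length A₁ * length A₂)       ≤⟨ ^-monoʳ-≤ 2 (ab≤[a+b]²/4 (length A₁) (length A₂)) ⟩
    2 ^ (((length A₁ + length A₂) * (length A₁ + length A₂)) / 4)
      ≡⟨ cong (λ l → 2 ^ ((l * l) / 4)) (halves A) ⟩
    2 ^ ((length A * length A) / 4)   ∎
    where
    A₁ = filter (λ u → c u Bool.≟ true) A
    A₂ = filter (λ u → c u Bool.≟ false) A
    halves : ∀ A → length (filter (λ u → c u Bool.≟ true) A) + length (filter (λ u → c u Bool.≟ false) A) ≡ length A
    halves []      = refl
    halves (x ∷ A) with c x
    ... | true  = cong suc (halves A)
    ... | false = trans (+-suc _ _) (cong suc (halves A))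
    no-arc : ∀ {d u w} → d ∈ F → u ∈ A → w ∈ A → c u ≡ c w → d u w ≡ false
    no-arc {d} {u} {w} d∈ u∈ w∈ e with d u w in eq
    ... | false = refl
    ... | true  = contradiction e (proper u∈ w∈ (arc⇒adj (oriented φ d∈) u∈ w∈ eq))
    agree : ∀ {d e} → d ∈ F → e ∈ F → (∀ {u w} → (u , w) ∈ cartesianProduct A₁ A₂ → d u w ≡ e u w) → Agree A d e
    agree {d} {e} d∈ e∈ h {u} {w} u∈ w∈ with c u in cu | c w in cw
    ... | true  | true  = trans (no-arc d∈ u∈ w∈ (trans cu (sym cw))) (sym (no-arc e∈ u∈ w∈ (trans cu (sym cw))))
    ... | false | false = trans (no-arc d∈ u∈ w∈ (trans cu (sym cw))) (sym (no-arc e∈ u∈ w∈ (trans cu (sym cw))))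
    ... | true  | false = h (∈-cartesianProduct⁺ (∈-filter⁺ _ u∈ cu) (∈-filter⁺ _ w∈ cw))
    ... | false | true  = trans (oriented φ d∈ w∈ u∈)
      (trans (cong (λ b → adj w u ∧ not b) (h (∈-cartesianProduct⁺ (∈-filter⁺ _ w∈ cw) (∈-filter⁺ _ u∈ cu))))
             (sym (oriented φ e∈ w∈ u∈)))

-- Counting bad orientations

-- All densities are multiples of 1/64, so estimates are compared after raising them to
-- the power 64; it is kept opaque so that a ^ c does not unfold.
abstract
  c : ℕ
  c = 64

  c≡64 : c ≡ 64
  c≡64 = refl

  0^c≡0 : 0 ^ c ≡ 0
  0^c≡0 = refl

  2^c-bound : 2 ^ c * 2 ≤ 2 ^ 65
  2^c-bound = ≤ᵇ⇒≤ _ _ tt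

  17^c-bound : 17 ^ c * 2 ≤ 2 ^ 263
  17^c-bound = ≤ᵇ⇒≤ _ _ tt

  193^c-bound : 193 ^ c * 2 ≤ 2 ^ 487
  193^c-bound = ≤ᵇ⇒≤ _ _ tt

  193^c-lower : 2 ^ 485 ≤ 193 ^ c
  193^c-lower = ≤ᵇ⇒≤ _ _ tt

  root-c : ∀ {a b} → a ^ c ≤ b ^ c → a ≤ b
  root-c {a} {b} h with a ≤? b
  ... | yes a≤b = a≤b
  ... | no a≰b = contradiction (≤-trans (^-monoˡ-< 64 (≰⇒> a≰b)) h) (<-irrefl refl)

pow-c : ∀ a → (2 ^ a) ^ c ≡ 2 ^ (a * 64)
pow-c a = trans (^-*-assoc 2 a c) (cong (λ e → 2 ^ (a * e)) c≡64)

cancel-2^ : ∀ a {x y} → x * 2 ^ a ≤ y * 2 ^ a → x ≤ y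
cancel-2^ a = *-cancelʳ-≤ _ _ (2 ^ a) ⦃ m^n≢0 2 a ⦄

-- `ℓ` is the exponent per vertex guaranteed by the weights and `s` the exponent paid for them. The
-- spare factor 2 in the bound on `S` accumulates over the n vertices to the saving `2 ^ n`, which
-- is 2^(n/64) after the root of order 64.
slack : ∀ f N S n ℓ s r → f ^ c * 2 ^ (n * ℓ) ≤ (N * S ^ n) ^ c → S ^ c * 2 ≤ 2 ^ s → s ≤ ℓ + r * 32 →
  f ^ c * 2 ^ n ≤ N ^ c * 2 ^ (n * (r * 32))
slack f N S n ℓ s r h hS hs = cancel-2^ (n * ℓ) (begin
  f ^ c * 2 ^ n * 2 ^ (n * ℓ)     ≡⟨ swap (f ^ c) (2 ^ n) (2 ^ (n * ℓ)) ⟩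
  f ^ c * 2 ^ (n * ℓ) * 2 ^ n     ≤⟨ *-monoˡ-≤ (2 ^ n) h ⟩
  (N * S ^ n) ^ c * 2 ^ n         ≡⟨ cong (_* 2 ^ n) (^-distribʳ-* c N (S ^ n)) ⟩
  N ^ c * (S ^ n) ^ c * 2 ^ n     ≡⟨ *-assoc (N ^ c) _ _ ⟩
  N ^ c * ((S ^ n) ^ c * 2 ^ n)   ≡⟨ cong (λ z → N ^ c * (z * 2 ^ n)) (power-swap S) ⟩
  N ^ c * ((S ^ c) ^ n * 2 ^ n)   ≡⟨ cong (N ^ c *_) (sym (^-distribʳ-* n (S ^ c) 2)) ⟩
  N ^ c * (S ^ c * 2) ^ n         ≤⟨ *-monoʳ-≤ (N ^ c) (^-monoˡ-≤ n hS) ⟩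
  N ^ c * (2 ^ s) ^ n             ≡⟨ cong (N ^ c *_) (trans (^-*-assoc 2 s n) (cong (2 ^_) (*-comm s n))) ⟩
  N ^ c * 2 ^ (n * s)             ≤⟨ *-monoʳ-≤ (N ^ c) (^-monoʳ-≤ 2 (*-monoʳ-≤ n hs)) ⟩
  N ^ c * 2 ^ (n * (ℓ + r * 32))  ≡⟨ cong (λ e → N ^ c * 2 ^ e) (trans (*-distribˡ-+ n ℓ (r * 32)) (+-comm (n * ℓ) _)) ⟩
  N ^ c * 2 ^ (n * (r * 32) + n * ℓ) ≡⟨ cong (N ^ c *_) (^-distribˡ-+-* 2 (n * (r * 32)) (n * ℓ)) ⟩
  N ^ c * (2 ^ (n * (r * 32)) * 2 ^ (n * ℓ)) ≡⟨ sym (*-assoc (N ^ c) _ _) ⟩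
  N ^ c * 2 ^ (n * (r * 32)) * 2 ^ (n * ℓ) ∎)
  where
  swap : ∀ a b c → a * b * c ≡ a * c * b
  swap = solve-∀
  power-swap : ∀ S → (S ^ n) ^ c ≡ (S ^ c) ^ n
  power-swap S = trans (^-*-assoc S n c) (trans (cong (S ^_) (*-comm n c)) (sym (^-*-assoc S c n)))

argmin : ∀ (f : X → ℕ) x xs → ∃ λ y → y ∈ x ∷ xs × (∀ {z} → z ∈ x ∷ xs → f y ≤ f z)
argmin f x [] = x , here refl , λ { (here refl) → ≤-refl }
argmin f x (x′ ∷ xs) with y , y∈ , least ← argmin f x′ xs with ≤-total (f x) (f y)
... | inj₁ h = x , here refl , λ { (here refl) → ≤-refl ; (there z∈) → ≤-trans h (least z∈) }
... | inj₂ h = y , there y∈ , λ { (here refl) → h ; (there z∈) → least z∈ }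

complement-bound : ∀ p q n i j → p + q ≡ n → p * (i + j) ≤ n * i → n * j ≤ q * (i + j)
complement-bound p q n i j refl h = +-cancelˡ-≤ ((p + q) * i) _ _ (begin
  (p + q) * i + (p + q) * j     ≡⟨ sym (*-distribˡ-+ (p + q) i j) ⟩
  (p + q) * (i + j)             ≡⟨ *-distribʳ-+ (i + j) p q ⟩
  p * (i + j) + q * (i + j)     ≤⟨ +-monoˡ-≤ _ h ⟩
  (p + q) * i + q * (i + j)     ∎)

∏-if-1 : ∀ (p : X → Bool) a xs → ∏ (λ x → if p x then 1 else 2 ^ a) xs ≡ 2 ^ (a * count (not ∘ p) xs)
∏-if-1 p a xs = trans (∏-if p 1 (2 ^ a) xs) (trans (cong (_* (2 ^ a) ^ count (not ∘ p) xs) (^-zeroˡ (count p xs)))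
  (trans (*-identityˡ _) (^-*-assoc 2 a _)))

-- If `p` has density at most i/64, at least j/64 of the elements carry the weight 2^a.
rare-weight : ∀ (p : X → Bool) xs a i j → i + j ≡ 64 → count p xs * 64 ≤ length xs * i →
  2 ^ (length xs * (a * j)) ≤ ∏ (λ x → if p x then 1 else 2 ^ a) xs ^ c
rare-weight p xs a i j ij h = begin
  2 ^ (length xs * (a * j))                ≡⟨ cong (2 ^_) (swap (length xs) a j) ⟩
  2 ^ (a * (length xs * j))                ≤⟨ ^-monoʳ-≤ 2 (*-monoʳ-≤ a bound) ⟩
  2 ^ (a * (count (not ∘ p) xs * 64))      ≡⟨ cong (2 ^_) (sym (*-assoc a _ 64)) ⟩
  2 ^ (a * count (not ∘ p) xs * 64)        ≡⟨ sym (pow-c (a * count (not ∘ p) xs)) ⟩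
  (2 ^ (a * count (not ∘ p) xs)) ^ c       ≡⟨ cong (_^ c) (sym (∏-if-1 p a xs)) ⟩
  ∏ (λ x → if p x then 1 else 2 ^ a) xs ^ c ∎
  where
  swap : ∀ n a j → n * (a * j) ≡ a * (n * j)
  swap = solve-∀
  bound : length xs * j ≤ count (not ∘ p) xs * 64
  bound = subst (λ z → length xs * j ≤ count (not ∘ p) xs * z) ij
    (complement-bound (count p xs) (count (not ∘ p) xs) (length xs) i j (count-not p xs)
      (subst (λ z → count p xs * z ≤ length xs * i) (sym ij) h))

module Classes {V : Set} (_≟_ : DecidableEquality V) (adj : V → V → Bool)
  (adj-sym : ∀ u v → adj u v ≡ adj v u) (L : ℕ) where

  open Counting _≟_ adj adj-sym L
  open Family

  -- Deleting r vertices lowers 2 ^ (n² / 4) by a factor of about 2 ^ (r n / 2); the bound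
  -- saves a further 2 ^ (n / 64).
  Slack : List V → ℕ → ℕ → ℕ → Set
  Slack A r f N = f ^ c * 2 ^ length A ≤ N ^ c * 2 ^ (length A * (r * 32))

  class-slack : ∀ {A T F N} (ω : V → List Bool → ℕ) S ℓ s r →
    (∀ {u} → u ∈ T → u ∈ A) → Bounded (A ∖ T) N → Family A F →
    (∀ {d} → d ∈ F → 2 ^ (length A * ℓ) ≤ ∏ (λ w → ω w (code T w d)) A ^ c) →
    (∀ {w} → w ∈ A → ∑ (ω w) (codes T w) ≤ S) →
    S ^ c * 2 ≤ 2 ^ s → s ≤ ℓ + r * 32 → Slack A r (length F) N
  class-slack {A} {T} {[]} {N} ω S ℓ s r T⊆A bound φ hω hS h₁ h₂ =
    subst (λ z → z * 2 ^ length A ≤ N ^ c * 2 ^ (length A * (r * 32))) (sym 0^c≡0) z≤n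
  class-slack {A} {T} {F@(d₀ ∷ F₀)} {N} ω S ℓ s r T⊆A bound φ hω hS h₁ h₂
    -- The least weight product is attained by a member, so it serves as `Λ` and still satisfies the
    -- lower bound.
    with d , d∈ , least ← argmin (λ d → ∏ (λ w → ω w (code T w d)) A) d₀ F₀ =
    slack (length F) N S (length A) ℓ s r (begin
      length F ^ c * 2 ^ (length A * ℓ)  ≤⟨ *-monoʳ-≤ (length F ^ c) (hω d∈) ⟩
      length F ^ c * Λ ^ c               ≡⟨ sym (^-distribʳ-* c (length F) Λ) ⟩
      (length F * Λ) ^ c                 ≤⟨ ^-monoˡ-≤ c (class-bound ω Λ S T⊆A bound φ least hS) ⟩
      (N * S ^ length A) ^ c             ∎) h₁ h₂
    where
    Λ = ∏ (λ w → ω w (code T w d)) A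

  nbr≡adj : ∀ {A d x w} → Oriented A d → x ∈ A → w ∈ A → nbr d x w ≡ adj x w
  nbr≡adj {A} {d} {x} {w} o x∈ w∈ with d x w in eq
  ... | true  = sym (arc⇒adj o x∈ w∈ eq)
  ... | false = trans (o x∈ w∈) (trans (cong (λ b → adj x w ∧ not b) eq) (Bool.∧-identityʳ _))

  count-cong : ∀ {A : List V} {p q : V → Bool} → (∀ {w} → w ∈ A → p w ≡ q w) → count p A ≡ count q A
  count-cong {[]}    h = refl
  count-cong {w ∷ A} h = cong₂ _+_ (cong bit (h (here refl))) (count-cong (h ∘ there))

  ∈-one : ∀ {A : List V} {x u} → x ∈ A → u ∈ x ∷ [] → u ∈ A
  ∈-one x∈ (here refl) = x∈

  -- A non-neighbour of x has a single pattern and can carry weight 2 at the same total cost 2 as a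
  -- neighbour. At least 33/64 of the vertices are non-neighbours, and 65 = 33 + 32.
  degree-slack : ∀ {A F x N} → x ∈ A → Bounded (A ∖ (x ∷ [])) N → Family A F →
    (∀ {d} → d ∈ F → count (nbr d x) A * 64 < length A * 31) → Slack A 1 (length F) N
  degree-slack {A} {F} {x} x∈ bound φ bad = class-slack {T = x ∷ []} (λ w _ → if adj x w then 1 else 2 ^ 1) 2 33 65 1
    (∈-one x∈) bound φ
    (λ d∈ → rare-weight (adj x) A 1 31 33 refl
      (≤-trans (≤-reflexive (cong (_* 64) (count-cong (λ w∈ → sym (nbr≡adj (oriented φ d∈) x∈ w∈))))) (<⇒≤ (bad d∈))))
    (λ {w} _ → total w) 2^c-bound ≤-refl
    where
    total : ∀ w → ∑ (λ _ → if adj x w then 1 else 2 ^ 1) (codes (x ∷ []) w) ≤ 2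
    total w with adj x w
    ... | true  = ≤-refl
    ... | false = ≤-refl

  head-weight : (Bool → Bool) → List Bool → ℕ
  head-weight g (b ∷ _) = if g b then 1 else 2 ^ 4
  head-weight g []      = 0

  -- The pattern that occurs too rarely gets weight 1 and the other one 2^4, at total cost at most
  -- 17. At least 60/64 of the vertices carry 2^4, which gives 4 · 60 = 240, and 263 is below 240 +
  -- 32.
  rare-slack : ∀ {A F x N} → x ∈ A → Bounded (A ∖ (x ∷ [])) N → Family A F →
    (p : V → Digraph V → Bool) (g : V → Bool → Bool) →
    (∀ {d w} → d ∈ F → w ∈ A → p w d ≡ g w (d x w)) →
    (∀ w → ∑ (head-weight (g w)) (codes (x ∷ []) w) ≤ 17) →
    (∀ {d} → d ∈ F → count (λ w → p w d) A * 16 < length A) → Slack A 1 (length F) N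
  rare-slack {A} {F} {x} x∈ bound φ p g p≡g total bad = class-slack {T = x ∷ []}
    (λ w → head-weight (g w)) 17 240 263 1
    (∈-one x∈) bound φ
    (λ {d} d∈ → ≤-trans (rare-weight (λ w → p w d) A 4 4 60 refl (fourfold {count (λ w → p w d) A} (bad d∈)))
      (^-monoˡ-≤ c (∏-mono A (λ w∈ → ≤-reflexive (cong (λ b → if b then 1 else 2 ^ 4) (p≡g d∈ w∈))))))
    (λ {w} _ → total w) 17^c-bound (≤ᵇ⇒≤ _ _ tt)
    where
    fourfold : ∀ {a n} → a * 16 < n → a * 64 ≤ n * 4
    fourfold {a} h = ≤-trans (≤-reflexive (sym (*-assoc a 16 4))) (*-monoˡ-≤ 4 (<⇒≤ h))

  outdegree-slack : ∀ {A F x N} → x ∈ A → Bounded (A ∖ (x ∷ [])) N → Family A F →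
    (∀ {d} → d ∈ F → count (d x) A * 16 < length A) → Slack A 1 (length F) N
  outdegree-slack {x = x} x∈ bound φ = rare-slack x∈ bound φ (λ w d → d x w) (λ w b → b) (λ _ _ → refl) total
    where
    total : ∀ w → ∑ (head-weight (λ b → b)) (codes (x ∷ []) w) ≤ 17
    total w with adj x w
    ... | true  = ≤ᵇ⇒≤ _ _ tt
    ... | false = ≤ᵇ⇒≤ _ _ tt

  indegree-slack : ∀ {A F x N} → x ∈ A → Bounded (A ∖ (x ∷ [])) N → Family A F →
    (∀ {d} → d ∈ F → count (λ w → d w x) A * 16 < length A) → Slack A 1 (length F) N
  indegree-slack {x = x} x∈ bound φ = rare-slack x∈ bound φ (λ w d → d w x) (λ w b → adj x w ∧ not b)
    (λ d∈ w∈ → oriented φ d∈ x∈ w∈) total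
    where
    total : ∀ w → ∑ (head-weight (λ b → adj x w ∧ not b)) (codes (x ∷ []) w) ≤ 17
    total w = by-adjacency (adj x w)
      where
      by-adjacency : ∀ a → head-weight (λ b → a ∧ not b) (false ∷ []) +
        ∑ (head-weight (λ b → a ∧ not b)) (if a then (true ∷ []) ∷ [] else []) ≤ 17
      by-adjacency true  = ≤ᵇ⇒≤ _ _ tt
      by-adjacency false = ≤ᵇ⇒≤ _ _ tt

  -- Reads the number of out-neighbours of w in Q off its code: a `false` bit is an arc from w only
  -- on an edge, so `adj` must be consulted.
  falses : V → List V → List Bool → ℕ
  falses w (u ∷ Q) (b ∷ bs) = bit (adj u w ∧ not b) + falses w Q bs
  falses w _       _        = 0

  trues-code : ∀ (d : Digraph V) w Q → count id (code Q w d) ≡ inn d Q w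
  trues-code d w []      = refl
  trues-code d w (u ∷ Q) = cong (bit (d u w) +_) (trues-code d w Q)

  falses-code : ∀ {A d w} → Oriented A d → w ∈ A → ∀ Q → (∀ {u} → u ∈ Q → u ∈ A) →
    falses w Q (code Q w d) ≡ out d Q w
  falses-code o w∈ []      Q⊆A = refl
  falses-code o w∈ (u ∷ Q) Q⊆A = cong₂ _+_ (cong bit (sym (o (Q⊆A (here refl)) w∈))) (falses-code o w∈ Q (Q⊆A ∘ there))

  ∑-codes : ∀ (f : List Bool → ℕ) u Q w → ∑ f (codes (u ∷ Q) w) ≡
    ∑ (f ∘ (false ∷_)) (codes Q w) + (if adj u w then ∑ (f ∘ (true ∷_)) (codes Q w) else 0)
  ∑-codes f u Q w with adj u w
  ... | true  = trans (∑-++ f (map (false ∷_) (codes Q w)) _) (cong₂ _+_ (∑-map f (false ∷_) (codes Q w)) (∑-map f (true ∷_) (codes Q w)))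
  ... | false = trans (∑-++ f (map (false ∷_) (codes Q w)) []) (cong (_+ 0) (∑-map f (false ∷_) (codes Q w)))

  codes-total : ∀ Q w → ∑ (λ _ → 1) (codes Q w) ≤ 2 ^ length Q
  codes-total []      w = ≤-refl
  codes-total (u ∷ Q) w rewrite ∑-codes (λ _ → 1) u Q w with adj u w
  ... | true  = +-mono-≤ (codes-total Q w) (≤-trans (codes-total Q w) (m≤m+n _ 0))
  ... | false = +-mono-≤ (codes-total Q w) z≤n

  private
    -- Pascal's recursion for a polynomial upper bound on sums of binomial coefficients.
    binomial-step : ∀ t m {a b} → a ≤ suc t ^ suc m → b ≤ suc t ^ m → a + b ≤ suc (suc t) ^ suc m
    binomial-step t m {a} {b} ha hb = begin
      a + b                             ≤⟨ +-mono-≤ ha hb ⟩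
      suc t * suc t ^ m + suc t ^ m     ≡⟨ +-comm _ (suc t ^ m) ⟩
      suc (suc t) * suc t ^ m           ≤⟨ *-monoʳ-≤ (suc (suc t)) (^-monoˡ-≤ m (n≤1+n (suc t))) ⟩
      suc (suc t) * suc (suc t) ^ m     ∎

    none : ∀ {xs : List (List Bool)} (f : List Bool → ℕ) → ∑ (λ bs → bit (f bs <ᵇ 0)) xs ≤ 0
    none {[]}     f = z≤n
    none {x ∷ xs} f = none {xs} f

    one : ∀ m → bit (0 <ᵇ m) + 0 ≤ 1 ^ m
    one zero    = z≤n
    one (suc m) = ≤-reflexive (sym (^-zeroˡ (suc m)))

  few-trues : ∀ Q w m → ∑ (λ bs → bit (count id bs <ᵇ m)) (codes Q w) ≤ suc (length Q) ^ m
  few-trues []      w m       = one m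
  few-trues (u ∷ Q) w zero    = ≤-trans (none {codes (u ∷ Q) w} (count id)) z≤n
  few-trues (u ∷ Q) w (suc m) rewrite ∑-codes (λ bs → bit (count id bs <ᵇ suc m)) u Q w with adj u w
  ... | true  = binomial-step (length Q) m (few-trues Q w (suc m)) (few-trues Q w m)
  ... | false = binomial-step (length Q) m (few-trues Q w (suc m)) z≤n

  few-falses : ∀ Q w m → ∑ (λ bs → bit (falses w Q bs <ᵇ m)) (codes Q w) ≤ suc (length Q) ^ m
  few-falses []      w m       = one m
  few-falses (u ∷ Q) w zero    = ≤-trans (none {codes (u ∷ Q) w} (falses w (u ∷ Q))) z≤n
  few-falses (u ∷ Q) w (suc m) rewrite ∑-codes (λ bs → bit (falses w (u ∷ Q) bs <ᵇ suc m)) u Q w with adj u w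
  ... | true  = ≤-trans (≤-reflexive (+-comm (∑ _ (codes Q w)) _))
                  (binomial-step (length Q) m (few-falses Q w (suc m)) (few-falses Q w m))
  ... | false = binomial-step (length Q) m (few-falses Q w (suc m)) z≤n

  expand-weight : ℕ → List V → V → List Bool → ℕ
  expand-weight m Q w bs = if (m ≤ᵇ count id bs) ∧ (m ≤ᵇ falses w Q bs) then 1 else 2 ^ length Q

  -- At most 2^q patterns have weight 1. Those with fewer than m in- or out-neighbours weigh 2^q
  -- each, but there are only polynomially many of them.
  expand-total : ∀ m Q w → ∑ (expand-weight m Q w) (codes Q w) ≤ 2 ^ length Q * (1 + 2 * suc (length Q) ^ m)
  expand-total m Q w = begin
    ∑ (expand-weight m Q w) (codes Q w)
      ≤⟨ ∑-mono (codes Q w) (λ {bs} _ → pointwise (count id bs) (falses w Q bs)) ⟩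
    ∑ (λ bs → 1 + (bit (count id bs <ᵇ m) + bit (falses w Q bs <ᵇ m)) * M) (codes Q w)
      ≡⟨ ∑-+ _ _ (codes Q w) ⟩
    ∑ (λ _ → 1) (codes Q w) + ∑ (λ bs → (bit (count id bs <ᵇ m) + bit (falses w Q bs <ᵇ m)) * M) (codes Q w)
      ≡⟨ cong (∑ (λ _ → 1) (codes Q w) +_) (trans (∑-*ʳ _ M (codes Q w)) (cong (_* M) (∑-+ _ _ (codes Q w)))) ⟩
    ∑ (λ _ → 1) (codes Q w) + (∑ (λ bs → bit (count id bs <ᵇ m)) (codes Q w) + ∑ (λ bs → bit (falses w Q bs <ᵇ m)) (codes Q w)) * M
      ≤⟨ +-mono-≤ (codes-total Q w) (*-monoˡ-≤ M (+-mono-≤ (few-trues Q w m) (few-falses Q w m))) ⟩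
    M + (P + P) * M ≡⟨ collect M P ⟩
    M * (1 + 2 * P) ∎
    where
    M = 2 ^ length Q
    P = suc (length Q) ^ m
    collect : ∀ M P → M + (P + P) * M ≡ M * (1 + 2 * P)
    collect = solve-∀
    ≰-<ᵇ : ∀ {a} → (m ≤ᵇ a) ≡ false → bit (a <ᵇ m) ≡ 1
    ≰-<ᵇ {a} e with a <ᵇ m in eq
    ... | true  = refl
    ... | false = contradiction (trans (sym e) (true-≤ᵇ {m} {a} (≮⇒≥ λ a<m →
                    contradiction (trans (sym (Equivalence.to Bool.T-≡ (<⇒<ᵇ a<m))) eq) λ ()))) λ ()
    pointwise : ∀ a b → (if (m ≤ᵇ a) ∧ (m ≤ᵇ b) then 1 else M) ≤ 1 + (bit (a <ᵇ m) + bit (b <ᵇ m)) * M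
    pointwise a b with m ≤ᵇ a in ea | m ≤ᵇ b in eb
    ... | true  | true  = s≤s z≤n
    ... | false | _ rewrite ≰-<ᵇ {a} ea = ≤-trans (m≤m+n M _) (n≤1+n _)
    ... | true  | false rewrite ≰-<ᵇ {b} eb = ≤-trans (≤-trans (m≤m+n M _)
            (*-monoˡ-≤ M (m≤n+m 1 (bit (a <ᵇ m))))) (n≤1+n _)

  -- If K(Q) is small, at least 33/64 of the vertices carry weight 2^q. The cost is 2^q times a
  -- polynomial factor, and the hypothesis on `length Q` fits the 64th power of that factor into
  -- 2^q; hence the exponents 33q and 65q.
  expand-slack : ∀ {A F Q N} m → (1 + 2 * suc (length Q) ^ m) ^ c * 2 ≤ 2 ^ length Q →
    (∀ {u} → u ∈ Q → u ∈ A) → Bounded (A ∖ Q) N → Family A F →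
    (∀ {d} → d ∈ F → count (K d m Q) A * 64 < length A * 31) → Slack A (length Q) (length F) N
  expand-slack {A} {F} {Q} m hq Q⊆A bound φ bad =
    class-slack (expand-weight m Q) (2 ^ q * (1 + 2 * suc q ^ m)) (q * 33) (q * 65) q
      Q⊆A bound φ
      (λ {d} d∈ → ≤-trans (rare-weight (K d m Q) A q 31 33 refl (<⇒≤ (bad d∈)))
        (^-monoˡ-≤ c (∏-mono A (λ {w} w∈ → ≤-reflexive (cong (λ b → if b then 1 else 2 ^ q)
          (sym (cong₂ (λ i j → (m ≤ᵇ i) ∧ (m ≤ᵇ j)) (trues-code d w Q) (falses-code (oriented φ d∈) w∈ Q Q⊆A))))))))
      (λ {w} _ → expand-total m Q w)
      (begin
        (2 ^ q * (1 + 2 * suc q ^ m)) ^ c * 2        ≡⟨ cong (_* 2) (^-distribʳ-* c (2 ^ q) _) ⟩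
        (2 ^ q) ^ c * (1 + 2 * suc q ^ m) ^ c * 2    ≡⟨ *-assoc ((2 ^ q) ^ c) _ 2 ⟩
        (2 ^ q) ^ c * ((1 + 2 * suc q ^ m) ^ c * 2)  ≤⟨ *-monoʳ-≤ ((2 ^ q) ^ c) hq ⟩
        (2 ^ q) ^ c * 2 ^ q                          ≡⟨ cong (_* 2 ^ q) (pow-c q) ⟩
        2 ^ (q * 64) * 2 ^ q                         ≡⟨ sym (^-distribˡ-+-* 2 (q * 64) q) ⟩
        2 ^ (q * 64 + q)                             ≡⟨ cong (2 ^_) (sixty-five q) ⟩
        2 ^ (q * 65)                                 ∎)
      (≤-reflexive (*-distribˡ-+ q 33 32))
    where
    q = length Q
    sixty-five : ∀ q → q * 64 + q ≡ q * 65
    sixty-five = solve-∀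

  -- For an arc x → y a vertex w with y → w → x is exceptional; any other common neighbour
  -- has only three possible patterns, and 3 · 64 + 1 = 193.
  pair-weight : Bool → Bool → List Bool → ℕ
  pair-weight a a′ (b ∷ b′ ∷ _) =
    if b′ ∧ (a ∧ not b) then 1 else if a ∧ a′ then 64 else if a ∨ a′ then 96 else 193
  pair-weight a a′ _ = 0

  pair-total : ∀ x y w → ∑ (pair-weight (adj x w) (adj y w)) (codes (x ∷ y ∷ []) w) ≤ 193
  pair-total x y w = by-adjacency (adj x w) (adj y w)
    where
    tail-codes : Bool → List (List Bool)
    tail-codes a′ = (false ∷ []) ∷ (if a′ then (true ∷ []) ∷ [] else [])
    by-adjacency : ∀ a a′ → ∑ (pair-weight a a′)
      (map (false ∷_) (tail-codes a′) ++ (if a then map (true ∷_) (tail-codes a′) else [])) ≤ 193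
    by-adjacency false false = ≤ᵇ⇒≤ _ _ tt
    by-adjacency false true  = ≤ᵇ⇒≤ _ _ tt
    by-adjacency true  false = ≤ᵇ⇒≤ _ _ tt
    by-adjacency true  true  = ≤ᵇ⇒≤ _ _ tt

  -- Vertices outside the union weigh 193, more than 2^(485/64); inside they weigh at least 2^6,
  -- except for the fewer than q₀ vertices of `s`, which are lent a factor 64 each. The density 9/16
  -- gives 384 · 9/16 + 485 · 7/16 > 428, and the loan costs less than the surplus over 424.
  pair-lower : ∀ {A} (p s : V → Bool) (ω : V → ℕ) q₀ → count s A < q₀ → count p A * 16 ≤ length A * 9 →
    q₀ * 1024 ≤ length A →
    (∀ {w} → w ∈ A → (if p w then 64 else 193) ≤ ω w * (if s w then 64 else 1)) →
    2 ^ (length A * 424) ≤ ∏ ω A ^ c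
  pair-lower {A} p s ω q₀ hs hp hq pointwise = cancel-2^ (q₀ * 6 * 64) (begin
    2 ^ (n * 424) * 2 ^ (q₀ * 6 * 64)          ≡⟨ sym (^-distribˡ-+-* 2 (n * 424) (q₀ * 6 * 64)) ⟩
    2 ^ (n * 424 + q₀ * 6 * 64)                ≤⟨ ^-monoʳ-≤ 2 exponents ⟩
    2 ^ (6 * u * 64 + 485 * v)                 ≡⟨ ^-distribˡ-+-* 2 (6 * u * 64) (485 * v) ⟩
    2 ^ (6 * u * 64) * 2 ^ (485 * v)           ≡⟨ cong₂ _*_ (sym (pow-c (6 * u))) (sym (^-*-assoc 2 485 v)) ⟩
    (2 ^ (6 * u)) ^ c * (2 ^ 485) ^ v          ≤⟨ *-monoʳ-≤ ((2 ^ (6 * u)) ^ c) (^-monoˡ-≤ v 193^c-lower) ⟩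
    (2 ^ (6 * u)) ^ c * (193 ^ c) ^ v          ≡⟨ cong ((2 ^ (6 * u)) ^ c *_) (power-swap 193 c v) ⟩
    (2 ^ (6 * u)) ^ c * (193 ^ v) ^ c          ≡⟨ sym (^-distribʳ-* c (2 ^ (6 * u)) (193 ^ v)) ⟩
    (2 ^ (6 * u) * 193 ^ v) ^ c                ≡⟨ cong (λ z → (z * 193 ^ v) ^ c) (sym (^-*-assoc 2 6 u)) ⟩
    ((2 ^ 6) ^ u * 193 ^ v) ^ c                ≡⟨ cong (_^ c) (sym (∏-if p 64 193 A)) ⟩
    ∏ (λ w → if p w then 64 else 193) A ^ c    ≤⟨ ^-monoˡ-≤ c (∏-mono A pointwise) ⟩
    ∏ (λ w → ω w * (if s w then 64 else 1)) A ^ c ≡⟨ cong (_^ c) (∏-* ω _ A) ⟩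
    (∏ ω A * ∏ (λ w → if s w then 64 else 1) A) ^ c
      ≡⟨ cong (λ z → (∏ ω A * z) ^ c) (trans (∏-if s 64 1 A) (trans (cong (64 ^ count s A *_) (^-zeroˡ (count (not ∘ s) A))) (*-identityʳ _))) ⟩
    (∏ ω A * (2 ^ 6) ^ count s A) ^ c          ≡⟨ ^-distribʳ-* c (∏ ω A) _ ⟩
    ∏ ω A ^ c * ((2 ^ 6) ^ count s A) ^ c      ≡⟨ cong (λ z → ∏ ω A ^ c * z ^ c) (^-*-assoc 2 6 (count s A)) ⟩
    ∏ ω A ^ c * (2 ^ (6 * count s A)) ^ c      ≡⟨ cong (∏ ω A ^ c *_) (pow-c (6 * count s A)) ⟩
    ∏ ω A ^ c * 2 ^ (6 * count s A * 64)       ≤⟨ *-monoʳ-≤ (∏ ω A ^ c) (^-monoʳ-≤ 2 (*-monoˡ-≤ 64 few)) ⟩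
    ∏ ω A ^ c * 2 ^ (q₀ * 6 * 64)              ∎)
    where
    n = length A
    u = count p A
    v = count (not ∘ p) A
    power-swap : ∀ a i j → (a ^ i) ^ j ≡ (a ^ j) ^ i
    power-swap a i j = trans (^-*-assoc a i j) (trans (cong (a ^_) (*-comm i j)) (sym (^-*-assoc a j i)))
    few : 6 * count s A ≤ q₀ * 6
    few = ≤-trans (*-monoʳ-≤ 6 (<⇒≤ hs)) (≤-reflexive (*-comm 6 q₀))
    7n≤16v : n * 7 ≤ v * 16
    7n≤16v = complement-bound u v n 9 7 (count-not p A) hp
    exponents : n * 424 + q₀ * 6 * 64 ≤ 6 * u * 64 + 485 * v
    exponents = *-cancelʳ-≤ _ _ 16 (begin
      (n * 424 + q₀ * 6 * 64) * 16               ≡⟨ expand n q₀ ⟩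
      n * 6784 + q₀ * 1024 * 6                   ≤⟨ +-monoʳ-≤ (n * 6784) (*-monoˡ-≤ 6 hq) ⟩
      n * 6784 + n * 6                           ≤⟨ +-monoʳ-≤ (n * 6784) (*-monoʳ-≤ n (≤ᵇ⇒≤ 6 67 tt)) ⟩
      n * 6784 + n * 67                          ≡⟨ regroup n ⟩
      -- Here 6144 = 16 · 384, and 101 = 485 - 384 is the gain from each vertex outside the union.
      n * 6144 + n * 7 * 101                     ≤⟨ +-monoʳ-≤ (n * 6144) (*-monoˡ-≤ 101 7n≤16v) ⟩
      n * 6144 + v * 16 * 101                    ≡⟨ cong (λ z → z * 6144 + v * 16 * 101) (sym (count-not p A)) ⟩
      (u + v) * 6144 + v * 16 * 101              ≡⟨ collect u v ⟩
      (6 * u * 64 + 485 * v) * 16                ∎)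
      where
      expand : ∀ n q → (n * 424 + q * 6 * 64) * 16 ≡ n * 6784 + q * 1024 * 6
      expand = solve-∀
      regroup : ∀ n → n * 6784 + n * 67 ≡ n * 6144 + n * 7 * 101
      regroup = solve-∀
      collect : ∀ u v → (u + v) * 6144 + v * 16 * 101 ≡ (6 * u * 64 + 485 * v) * 16
      collect = solve-∀

  pair-slack : ∀ {A F x y N} q₀ → q₀ * 1024 ≤ length A → x ∈ A → y ∈ A →
    Bounded (A ∖ (x ∷ y ∷ [])) N → Family A F →
    (∀ {d} → d ∈ F → count (λ w → d y w ∧ d w x) A < q₀ ×
       count (λ w → nbr d x w ∨ nbr d y w) A * 16 < length A * 9) → Slack A 2 (length F) N
  pair-slack {A} {F} {x} {y} q₀ hq x∈ y∈ bound φ bad =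
    class-slack {T = x ∷ y ∷ []} (λ w → pair-weight (adj x w) (adj y w)) 193 424 487 2
      (λ { (here refl) → x∈ ; (there (here refl)) → y∈ }) bound φ
      (λ {d} d∈ → pair-lower (λ w → nbr d x w ∨ nbr d y w) (λ w → d y w ∧ d w x)
        (λ w → pair-weight (adj x w) (adj y w) (d x w ∷ d y w ∷ [])) q₀
        (proj₁ (bad d∈)) (<⇒≤ (proj₂ (bad d∈))) hq
        (λ {w} w∈ → subst₂ _≤_
          (cong (λ b → if b then 64 else 193) (sym (cong₂ _∨_ (nbr≡adj (oriented φ d∈) x∈ w∈) (nbr≡adj (oriented φ d∈) y∈ w∈))))
          (cong (λ b → pair-weight (adj x w) (adj y w) (d x w ∷ d y w ∷ []) * (if d y w ∧ b then 64 else 1)) (sym (oriented φ d∈ x∈ w∈)))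
          (pointwise (adj x w) (adj y w) (d x w) (d y w))))
      (λ {w} _ → pair-total x y w) 193^c-bound (≤ᵇ⇒≤ _ _ tt)
    where
    pointwise : ∀ a a′ b b′ → (if a ∨ a′ then 64 else 193) ≤
      pair-weight a a′ (b ∷ b′ ∷ []) * (if b′ ∧ (a ∧ not b) then 64 else 1)
    pointwise false false b false = ≤ᵇ⇒≤ _ _ tt
    pointwise false false b true  = ≤ᵇ⇒≤ _ _ tt
    pointwise false true  b false = ≤ᵇ⇒≤ _ _ tt
    pointwise false true  b true  = ≤ᵇ⇒≤ _ _ tt
    pointwise true  false b     false = ≤ᵇ⇒≤ _ _ tt
    pointwise true  false false true  = ≤ᵇ⇒≤ _ _ tt
    pointwise true  false true  true  = ≤ᵇ⇒≤ _ _ tt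
    pointwise true  true  b     false = ≤ᵇ⇒≤ _ _ tt
    pointwise true  true  false true  = ≤ᵇ⇒≤ _ _ tt
    pointwise true  true  true  true  = ≤ᵇ⇒≤ _ _ tt

-- Polynomial versus exponential growth

n<2^n : ∀ n → n < 2 ^ n
n<2^n zero    = s≤s z≤n
n<2^n (suc n) = begin-strict
  suc n             <⟨ s≤s (n<2^n n) ⟩
  suc (2 ^ n)       ≤⟨ +-monoˡ-≤ (2 ^ n) (m^n>0 2 n) ⟩
  2 ^ n + 2 ^ n     ≡⟨ cong (2 ^ n +_) (sym (+-identityʳ _)) ⟩
  2 ^ suc n         ∎

n<[1+n/m]*m : ∀ n m .⦃ _ : NonZero m ⦄ → n < suc (n / m) * m
n<[1+n/m]*m n m = begin-strict
  n                     ≡⟨ m≡m%n+[m/n]*n n m ⟩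
  n % m + n / m * m     <⟨ +-monoˡ-< (n / m * m) (m%n<n n m) ⟩
  m + n / m * m         ∎

-- With j = n / (a + 1) we have n < (a + 1)(j + 1) ≤ (a + 1) 2 ^ j.
poly≤exp : ∀ a b → ∃ λ N → ∀ n → N ≤ n → n ^ a * 2 ^ b ≤ 2 ^ n
poly≤exp a b = j₀ * a⁺ , λ n N≤n → let j = n / a⁺ in begin
    n ^ a * 2 ^ b                    ≤⟨ *-monoˡ-≤ (2 ^ b) (^-monoˡ-≤ a (n≤ n)) ⟩
    (2 ^ a⁺ * 2 ^ j) ^ a * 2 ^ b     ≡⟨ cong (λ z → z ^ a * 2 ^ b) (sym (^-distribˡ-+-* 2 a⁺ j)) ⟩
    (2 ^ (a⁺ + j)) ^ a * 2 ^ b       ≡⟨ cong (_* 2 ^ b) (^-*-assoc 2 (a⁺ + j) a) ⟩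
    2 ^ ((a⁺ + j) * a) * 2 ^ b       ≡⟨ sym (^-distribˡ-+-* 2 ((a⁺ + j) * a) b) ⟩
    2 ^ ((a⁺ + j) * a + b)           ≡⟨ cong (2 ^_) (regroup a⁺ j a b) ⟩
    2 ^ (j * a + j₀)                 ≤⟨ ^-monoʳ-≤ 2 (+-monoʳ-≤ (j * a) (j₀≤ n N≤n)) ⟩
    2 ^ (j * a + j)                  ≡⟨ cong (2 ^_) (trans (+-comm (j * a) j) (sym (*-suc j a))) ⟩
    2 ^ (j * a⁺)                     ≤⟨ ^-monoʳ-≤ 2 (m/n*n≤m n a⁺) ⟩
    2 ^ n                            ∎
  where
  a⁺ = suc a
  j₀ = a⁺ * a + b
  regroup : ∀ a⁺ j a b → (a⁺ + j) * a + b ≡ j * a + (a⁺ * a + b)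
  regroup = solve-∀
  n≤ : ∀ n → n ≤ 2 ^ a⁺ * 2 ^ (n / a⁺)
  n≤ n = begin
    n                       ≤⟨ <⇒≤ (n<[1+n/m]*m n a⁺) ⟩
    suc (n / a⁺) * a⁺       ≤⟨ *-mono-≤ (n<2^n (n / a⁺)) (<⇒≤ (n<2^n a⁺)) ⟩
    2 ^ (n / a⁺) * 2 ^ a⁺   ≡⟨ *-comm (2 ^ (n / a⁺)) _ ⟩
    2 ^ a⁺ * 2 ^ (n / a⁺)   ∎
  j₀≤ : ∀ n → j₀ * a⁺ ≤ n → j₀ ≤ n / a⁺
  j₀≤ n h = ≤-trans (≤-reflexive (sym (m*n/n≡m j₀ a⁺))) (/-monoˡ-≤ a⁺ h)

private
  constant : ∃ λ B → (2 ^ 2) ^ c * 2 ^ 2 ≡ 2 ^ B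
  constant = 2 * c + 2 , trans (cong (_* 2 ^ 2) (^-*-assoc 2 2 c)) (sym (^-distribˡ-+-* 2 (2 * c) 2))

-- Provides the constants q₀ and q₁: the 64th power of a polynomial in q is eventually below 2^q.
expansion-size : ∀ m lower → ∃ λ q → lower ≤ q × (1 + 2 * suc q ^ m) ^ c * 2 ≤ 2 ^ q
expansion-size m lower with B , 2^B ← constant with N , large ← poly≤exp (m * c) B =
  q , m≤m+n lower N , cancel-2^ 1 (begin
    (1 + 2 * P) ^ c * 2 * 2 ^ 1          ≡⟨ *-assoc ((1 + 2 * P) ^ c) 2 (2 ^ 1) ⟩
    (1 + 2 * P) ^ c * 2 ^ 2              ≤⟨ *-monoˡ-≤ (2 ^ 2) (^-monoˡ-≤ c 1+2P≤) ⟩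
    (P * 2 ^ 2) ^ c * 2 ^ 2              ≡⟨ cong (_* 2 ^ 2) (^-distribʳ-* c P (2 ^ 2)) ⟩
    P ^ c * (2 ^ 2) ^ c * 2 ^ 2          ≡⟨ *-assoc (P ^ c) _ _ ⟩
    P ^ c * ((2 ^ 2) ^ c * 2 ^ 2)        ≡⟨ cong₂ _*_ (^-*-assoc (suc q) m c) 2^B ⟩
    suc q ^ (m * c) * 2 ^ B              ≤⟨ large (suc q) (≤-trans (m≤n+m N lower) (n≤1+n q)) ⟩
    2 ^ suc q                            ≡⟨ *-comm 2 (2 ^ q) ⟩
    2 ^ q * 2 ^ 1                        ∎)
  where
  q = lower + N
  P = suc q ^ m
  1+2P≤ : 1 + 2 * P ≤ P * 2 ^ 2
  1+2P≤ = begin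
    1 + 2 * P ≤⟨ +-monoˡ-≤ (2 * P) (m^n>0 (suc q) m) ⟩
    P + 2 * P ≤⟨ m≤n+m _ P ⟩
    P + (P + 2 * P) ≡⟨ four P ⟩
    P * 2 ^ 2 ∎
    where
    four : ∀ P → P + (P + 2 * P) ≡ P * 4
    four = solve-∀

-- With s = n/128 about half of the saved exponent n/64 is used. The factor 12 n^R pays for 6 n^R
-- events and a further halving; `C` absorbs rounding errors.
polynomial-slack : ∀ R C → ∃ λ N → ∀ n → N ≤ n → ∃ λ s → n ^ R * 12 ≤ 2 ^ s × s * 64 + C ≤ n
polynomial-slack R C with N , large ← poly≤exp R (8 * R + 4) =
  (N + C + 1) * 128 , λ n N≤n → let s = n / 128 in s ,
    (begin
      n ^ R * 12                         ≤⟨ *-mono-≤ (^-monoˡ-≤ R (n≤ n N≤n)) (≤ᵇ⇒≤ 12 (2 ^ 4) tt) ⟩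
      (s * 2 ^ 8) ^ R * 2 ^ 4            ≡⟨ cong (_* 2 ^ 4) (^-distribʳ-* R s (2 ^ 8)) ⟩
      s ^ R * (2 ^ 8) ^ R * 2 ^ 4        ≡⟨ cong (λ z → s ^ R * z * 2 ^ 4) (^-*-assoc 2 8 R) ⟩
      s ^ R * 2 ^ (8 * R) * 2 ^ 4        ≡⟨ *-assoc (s ^ R) _ _ ⟩
      s ^ R * (2 ^ (8 * R) * 2 ^ 4)      ≡⟨ cong (s ^ R *_) (sym (^-distribˡ-+-* 2 (8 * R) 4)) ⟩
      s ^ R * 2 ^ (8 * R + 4)            ≤⟨ large s (≤-trans (≤-trans (m≤m+n N C) (m≤m+n _ 1)) (s-large n N≤n)) ⟩
      2 ^ s                              ∎) ,
    (begin
      s * 64 + C                         ≤⟨ +-monoʳ-≤ (s * 64) (≤-trans (≤-trans (m≤n+m C N) (m≤m+n _ 1)) (s-large n N≤n)) ⟩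
      s * 64 + s                         ≡⟨ trans (+-comm (s * 64) s) (sym (*-suc s 64)) ⟩
      s * 65                             ≤⟨ *-monoʳ-≤ s (≤ᵇ⇒≤ 65 128 tt) ⟩
      s * 128                            ≤⟨ m/n*n≤m n 128 ⟩
      n                                  ∎)
  where
  s-large : ∀ n → (N + C + 1) * 128 ≤ n → N + C + 1 ≤ n / 128
  s-large n h = ≤-trans (≤-reflexive (sym (m*n/n≡m (N + C + 1) 128))) (/-monoˡ-≤ 128 h)
  n≤ : ∀ n → (N + C + 1) * 128 ≤ n → n ≤ n / 128 * 2 ^ 8
  n≤ n h = begin
    n                             ≤⟨ <⇒≤ (n<[1+n/m]*m n 128) ⟩
    suc (n / 128) * 128           ≤⟨ *-monoˡ-≤ 128 (+-monoˡ-≤ (n / 128) (≤-trans (m≤n+m 1 (N + C)) (s-large n h))) ⟩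
    (n / 128 + n / 128) * 128     ≡⟨ double (n / 128) ⟩
    n / 128 * 2 ^ 8               ∎
    where
    double : ∀ s → (s + s) * 128 ≡ s * 256
    double = solve-∀

-- For m + r = n the identity m² + 2rn = n² + r², multiplied by 16, compares the two exponents. The
-- term 16r² and the rounding loss 16 · 3 = 48 from n²/4 form the constant.
class-exponent : ∀ f n m r e s → m + r ≡ n → s * 64 + (r * r * 16 + 48) ≤ n →
  f ^ c * 2 ^ n ≤ (2 ^ ((m * m) / 4 + e)) ^ c * 2 ^ (n * (r * 32)) → f * 2 ^ s ≤ 2 ^ ((n * n) / 4 + e)
class-exponent f n m r e s refl hs h = root-c (cancel-2^ C (begin
    (f * 2 ^ s) ^ c * 2 ^ C               ≡⟨ cong (_* 2 ^ C) (^-distribʳ-* c f (2 ^ s)) ⟩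
    f ^ c * (2 ^ s) ^ c * 2 ^ C           ≡⟨ *-assoc (f ^ c) _ _ ⟩
    f ^ c * ((2 ^ s) ^ c * 2 ^ C)         ≡⟨ cong (λ z → f ^ c * (z * 2 ^ C)) (pow-c s) ⟩
    f ^ c * (2 ^ (s * 64) * 2 ^ C)        ≡⟨ cong (f ^ c *_) (sym (^-distribˡ-+-* 2 (s * 64) C)) ⟩
    f ^ c * 2 ^ (s * 64 + C)              ≤⟨ *-monoʳ-≤ (f ^ c) (^-monoʳ-≤ 2 hs) ⟩
    f ^ c * 2 ^ n                         ≤⟨ h ⟩
    (2 ^ (M + e)) ^ c * 2 ^ (n * (r * 32)) ≡⟨ cong (_* 2 ^ (n * (r * 32))) (pow-c (M + e)) ⟩
    2 ^ ((M + e) * 64) * 2 ^ (n * (r * 32)) ≡⟨ sym (^-distribˡ-+-* 2 ((M + e) * 64) _) ⟩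
    2 ^ ((M + e) * 64 + n * (r * 32))     ≤⟨ ^-monoʳ-≤ 2 exponents ⟩
    2 ^ ((Q + e) * 64 + C)                ≡⟨ ^-distribˡ-+-* 2 ((Q + e) * 64) C ⟩
    2 ^ ((Q + e) * 64) * 2 ^ C            ≡⟨ cong (_* 2 ^ C) (sym (pow-c (Q + e))) ⟩
    (2 ^ (Q + e)) ^ c * 2 ^ C             ∎))
  where
  C = r * r * 16 + 48
  M = (m * m) / 4
  Q = (n * n) / 4
  regroup₁ : ∀ M e x → (M + e) * 64 + x ≡ M * 4 * 16 + (e * 64 + x)
  regroup₁ = solve-∀
  regroup₂ : ∀ m r e → m * m * 16 + (e * 64 + (m + r) * (r * 32)) ≡ (m + r) * (m + r) * 16 + (e * 64 + r * r * 16)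
  regroup₂ = solve-∀
  regroup₃ : ∀ Q e x → (3 + Q * 4) * 16 + (e * 64 + x) ≡ (Q + e) * 64 + (x + 48)
  regroup₃ = solve-∀
  exponents : (M + e) * 64 + n * (r * 32) ≤ (Q + e) * 64 + C
  exponents = begin
    (M + e) * 64 + n * (r * 32)                 ≡⟨ regroup₁ M e _ ⟩
    M * 4 * 16 + (e * 64 + n * (r * 32))        ≤⟨ +-monoˡ-≤ _ (*-monoˡ-≤ 16 (m/n*n≤m (m * m) 4)) ⟩
    m * m * 16 + (e * 64 + (m + r) * (r * 32))  ≡⟨ regroup₂ m r e ⟩
    n * n * 16 + (e * 64 + r * r * 16)          ≤⟨ +-monoˡ-≤ _ (*-monoˡ-≤ 16 (s≤s⁻¹ (n<[1+n/m]*m (n * n) 4))) ⟩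
    (3 + Q * 4) * 16 + (e * 64 + r * r * 16)    ≡⟨ regroup₃ Q e _ ⟩
    (Q + e) * 64 + C                            ∎

-- Induction on the number of vertices

<ᵇ-true : ∀ {m n} → (m <ᵇ n) ≡ true → m < n
<ᵇ-true {m} {n} e = <ᵇ⇒< m n (Equivalence.from Bool.T-≡ e)

<ᵇ-false : ∀ {m n} → (m <ᵇ n) ≡ false → n ≤ m
<ᵇ-false e = ≮⇒≥ λ h → contradiction (trans (sym (Equivalence.to Bool.T-≡ (<⇒<ᵇ h))) e) λ ()

search : ∀ (p : X → Bool) xs → (∃ λ x → x ∈ xs × p x ≡ false) ⊎ (∀ {x} → x ∈ xs → p x ≡ true)
search p [] = inj₂ λ ()
search p (x ∷ xs) with p x in eq
... | false = inj₁ (x , here refl , eq)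
... | true with search p xs
... | inj₁ (y , y∈ , e) = inj₁ (y , there y∈ , e)
... | inj₂ h = inj₂ λ { (here refl) → eq ; (there x∈) → h x∈ }

-- Tuples and kinds of violations

tuples : List X → ℕ → List (List X)
tuples A zero    = [] ∷ []
tuples A (suc r) = cartesianProductWith _∷_ A (tuples A r)

length-tuples : ∀ (A : List X) r → length (tuples A r) ≡ length A ^ r
length-tuples A zero    = refl
length-tuples A (suc r) = trans (length-with A (tuples A r)) (cong (length A *_) (length-tuples A r))
  where
  length-with : ∀ xs yss → length (cartesianProductWith _∷_ xs yss) ≡ length xs * length yss
  length-with []       yss = refl
  length-with (x ∷ xs) yss = trans (length-++ (map (x ∷_) yss)) (cong₂ _+_ (length-map (x ∷_) yss) (length-with xs yss))

∈-tuples⁺ : ∀ {A : List X} T → (∀ {u} → u ∈ T → u ∈ A) → T ∈ tuples A (length T)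
∈-tuples⁺ []      h = here refl
∈-tuples⁺ (x ∷ T) h = ∈-cartesianProductWith⁺ _∷_ (h (here refl)) (∈-tuples⁺ T (h ∘ there))

∈-tuples⁻ : ∀ {A : List X} r {T} → T ∈ tuples A r → length T ≡ r × (∀ {u} → u ∈ T → u ∈ A)
∈-tuples⁻ zero (here refl) = refl , λ ()
∈-tuples⁻ {A = A} (suc r) T∈ with x , T , x∈ , T∈′ , refl ← ∈-cartesianProductWith⁻ _∷_ A (tuples A r) T∈ =
  let l , h = ∈-tuples⁻ r T∈′ in cong suc l , λ { (here refl) → x∈ ; (there u∈) → h u∈ }

-- One kind of violation for each field of `Good`.
data Kind : Set where
  degᵏ outᵏ inᵏ exp₀ᵏ exp₁ᵏ pairᵏ : Kind

kinds : List Kind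
kinds = degᵏ ∷ outᵏ ∷ inᵏ ∷ exp₀ᵏ ∷ exp₁ᵏ ∷ pairᵏ ∷ []

∈-kinds : ∀ κ → κ ∈ kinds
∈-kinds degᵏ  = here refl
∈-kinds outᵏ  = there (here refl)
∈-kinds inᵏ   = there (there (here refl))
∈-kinds exp₀ᵏ = there (there (there (here refl)))
∈-kinds exp₁ᵏ = there (there (there (there (here refl))))
∈-kinds pairᵏ = there (there (there (there (there (here refl)))))

module Induction {V : Set} (_≟_ : DecidableEquality V) (adj : V → V → Bool)
  (adj-sym : ∀ u v → adj u v ≡ adj v u) (adj-irrefl : ∀ v → adj v v ≡ false)
  (k q₀ q₁ : ℕ) (m≤q₀ : 2 * k + 3 ≤ q₀) (q₀≤q₁ : q₀ ≤ q₁)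
  (hq₀ : (1 + 2 * suc q₀ ^ (2 * k + 3)) ^ c * 2 ≤ 2 ^ q₀)
  (hq₁ : (1 + 2 * suc q₁ ^ q₀) ^ c * 2 ≤ 2 ^ q₁) where

  open Counting _≟_ adj adj-sym (2 * k + 3)
  open Classes _≟_ adj adj-sym (2 * k + 3)
  open Family

  R σ : ℕ
  R = suc (suc (q₀ + q₁))
  σ = 4 * q₁ + (2 ^ q₁ * q₀ + q₀)

  arity : Kind → ℕ
  arity degᵏ  = 1
  arity outᵏ  = 1
  arity inᵏ   = 1
  arity exp₀ᵏ = q₀
  arity exp₁ᵏ = q₁
  arity pairᵏ = 2

  arity≤R : ∀ κ → arity κ ≤ R
  arity≤R degᵏ  = s≤s z≤n
  arity≤R outᵏ  = s≤s z≤n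
  arity≤R inᵏ   = s≤s z≤n
  arity≤R exp₀ᵏ = ≤-trans (m≤m+n q₀ q₁) (m≤n+m _ 2)
  arity≤R exp₁ᵏ = ≤-trans (m≤n+m q₁ q₀) (m≤n+m _ 2)
  arity≤R pairᵏ = s≤s (s≤s z≤n)

  bad : Kind → List V → List V → Digraph V → Bool
  bad degᵏ  A (x ∷ [])     d = count (nbr d x) A * 64 <ᵇ length A * 31
  bad outᵏ  A (x ∷ [])     d = count (d x) A * 16 <ᵇ length A
  bad inᵏ   A (x ∷ [])     d = count (λ w → d w x) A * 16 <ᵇ length A
  bad exp₀ᵏ A Q            d = count (K d (2 * k + 3) Q) A * 64 <ᵇ length A * 31
  bad exp₁ᵏ A Q            d = count (K d q₀ Q) A * 64 <ᵇ length A * 31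
  bad pairᵏ A (x ∷ y ∷ []) d = d x y ∧ ((count (λ w → d y w ∧ d w x) A <ᵇ q₀) ∧
                                        (count (λ w → nbr d x w ∨ nbr d y w) A * 16 <ᵇ length A * 9))
  bad _     _ _            _ = false

  unique? : (T : List V) → Dec (Unique T)
  unique? = UniqueDec.unique? _≟_

  -- Distinctness is part of the event because `tuples` also lists tuples with repetitions, for
  -- which deleting `T` would remove too few vertices.
  event : List V → Kind × List V → Digraph V → Bool
  event A (κ , T) d = does (unique? T) ∧ bad κ A T d

  events : List V → List (Kind × List V)
  events A = concatMap (λ κ → map (κ ,_) (tuples A (arity κ))) kinds

  ∈-concatMap : ∀ {κ j} (f : Kind → List (Kind × List V)) ks → κ ∈ ks → j ∈ f κ → j ∈ concatMap f ks
  ∈-concatMap f (κ ∷ ks) (here refl) j∈ = ∈-++⁺ˡ j∈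
  ∈-concatMap f (κ ∷ ks) (there κ∈)  j∈ = ∈-++⁺ʳ (f κ) (∈-concatMap f ks κ∈ j∈)

  ∈-events⁺ : ∀ {A} κ {T} → length T ≡ arity κ → (∀ {u} → u ∈ T → u ∈ A) → (κ , T) ∈ events A
  ∈-events⁺ {A} κ {T} l h = ∈-concatMap (λ κ → map (κ ,_) (tuples A (arity κ))) kinds (∈-kinds κ)
    (∈-map⁺ (κ ,_) (subst (λ r → T ∈ tuples A r) l (∈-tuples⁺ T h)))

  ∈-events⁻ : ∀ {A κ T} → (κ , T) ∈ events A → length T ≡ arity κ × (∀ {u} → u ∈ T → u ∈ A)
  ∈-events⁻ {A} = go kinds
    where
    go : ∀ ks {κ T} → (κ , T) ∈ concatMap (λ κ → map (κ ,_) (tuples A (arity κ))) ks →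
      length T ≡ arity κ × (∀ {u} → u ∈ T → u ∈ A)
    go (κ ∷ ks) j∈ with ∈-++⁻ (map (κ ,_) (tuples A (arity κ))) j∈
    ... | inj₂ j∈′ = go ks j∈′
    ... | inj₁ j∈′ with T , T∈ , refl ← ∈-map⁻ (κ ,_) j∈′ = ∈-tuples⁻ (arity κ) T∈

  length-events : ∀ A → 0 < length A → length (events A) ≤ 6 * length A ^ R
  length-events A 0<n = go kinds
    where
    go : ∀ ks → length (concatMap (λ κ → map (κ ,_) (tuples A (arity κ))) ks) ≤ length ks * length A ^ R
    go []       = z≤n
    go (κ ∷ ks) = begin
      length (map (κ ,_) (tuples A (arity κ)) ++ _) ≡⟨ length-++ (map (κ ,_) (tuples A (arity κ))) ⟩
      length (map (κ ,_) (tuples A (arity κ))) + _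
        ≤⟨ +-mono-≤ (≤-trans (≤-reflexive (trans (length-map (κ ,_) (tuples A (arity κ))) (length-tuples A (arity κ))))
                       (^-monoʳ-≤ (length A) ⦃ >-nonZero 0<n ⦄ (arity≤R κ))) (go ks) ⟩
      length A ^ R + length ks * length A ^ R ∎

  event-slack : ∀ {A F N} κ T → σ * 1024 ≤ length A → length T ≡ arity κ → (∀ {u} → u ∈ T → u ∈ A) →
    Bounded (A ∖ T) N → Family A F → (∀ {d} → d ∈ F → bad κ A T d ≡ true) → Slack A (arity κ) (length F) N
  event-slack degᵏ (x ∷ []) large l T⊆A bound φ b =
    degree-slack (T⊆A (here refl)) bound φ (<ᵇ-true ∘ b)
  event-slack outᵏ (x ∷ []) large l T⊆A bound φ b =
    outdegree-slack (T⊆A (here refl)) bound φ (<ᵇ-true ∘ b)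
  event-slack inᵏ (x ∷ []) large l T⊆A bound φ b =
    indegree-slack (T⊆A (here refl)) bound φ (<ᵇ-true ∘ b)
  event-slack exp₀ᵏ Q large refl T⊆A bound φ b =
    expand-slack (2 * k + 3) hq₀ T⊆A bound φ (<ᵇ-true ∘ b)
  event-slack exp₁ᵏ Q large refl T⊆A bound φ b =
    expand-slack q₀ hq₁ T⊆A bound φ (<ᵇ-true ∘ b)
  event-slack {A} pairᵏ (x ∷ y ∷ []) large l T⊆A bound φ b =
    pair-slack q₀ (≤-trans (*-monoˡ-≤ 1024 q₀≤σ) large) (T⊆A (here refl)) (T⊆A (there (here refl))) bound φ
      λ {d} d∈ → let e = ∧-right {d x y} (b d∈) in
        <ᵇ-true (∧-left e) , <ᵇ-true (∧-right {count (λ w → d y w ∧ d w x) A <ᵇ q₀} e)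
    where
    q₀≤σ : q₀ ≤ σ
    q₀≤σ = ≤-trans (m≤n+m q₀ (2 ^ q₁ * q₀)) (m≤n+m _ (4 * q₁))

  good : ∀ {A d} → (∀ {x y} → x ∈ A → d x y ≡ true → x ≢ y) →
    (∀ {j} → j ∈ events A → event A j d ≡ false) → Good k q₀ q₁ A d
  good {A} {d} loopless none = record
    { expand₀   = λ l u Q⊆A → <ᵇ-false (not-bad exp₀ᵏ l u Q⊆A)
    ; expand₁   = λ l u Q⊆A → <ᵇ-false (not-bad exp₁ᵏ l u Q⊆A)
    ; degree    = λ {x} x∈ → <ᵇ-false (not-bad degᵏ {x ∷ []} refl ([] ∷ []) (λ { (here refl) → x∈ }))
    ; outdegree = λ {x} x∈ → <ᵇ-false (not-bad outᵏ {x ∷ []} refl ([] ∷ []) (λ { (here refl) → x∈ }))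
    ; indegree  = λ {x} x∈ → <ᵇ-false (not-bad inᵏ {x ∷ []} refl ([] ∷ []) (λ { (here refl) → x∈ }))
    ; adjacent  = λ {x} {y} x∈ y∈ x→y few → <ᵇ-false (trans (sym (pair-bad {x} {y} x→y few))
        (not-bad pairᵏ {x ∷ y ∷ []} refl ((loopless x∈ x→y ∷ []) ∷ [] ∷ [])
          (λ { (here refl) → x∈ ; (there (here refl)) → y∈ })))
    }
    where
    not-bad : ∀ κ {T} → length T ≡ arity κ → Unique T → (∀ {u} → u ∈ T → u ∈ A) → bad κ A T d ≡ false
    not-bad κ {T} l u T⊆A with none (∈-events⁺ κ {T} l T⊆A)
    ... | e with unique? T
    ... | yes _ = e
    ... | no ¬u = contradiction u ¬u
    pair-bad : ∀ {x y} → d x y ≡ true → count (λ w → d y w ∧ d w x) A < q₀ →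
      bad pairᵏ A (x ∷ y ∷ []) d ≡ (count (λ w → nbr d x w ∨ nbr d y w) A * 16 <ᵇ length A * 9)
    pair-bad {x} {y} x→y few rewrite x→y | Equivalence.to Bool.T-≡ (<⇒<ᵇ few) = refl

  -- A single good member suffices: it orients every edge, so its colouring is proper for the
  -- underlying graph, and this bounds the whole family.
  good-bound : ∀ {A F d} → Unique A → σ * 1024 ≤ length A → Family A F → d ∈ F →
    (∀ {j} → j ∈ events A → event A j d ≡ false) → length F ≤ 2 ^ ((length A * length A) / 4)
  good-bound {A} {F} {d} uA large φ d∈ none =
    let col , proper = Structure.colouring _≟_ k q₀ q₁ A uA d loopless (free φ d∈) (good loopless none) m≤q₀ large
    in bipartite-bound col (adj-proper col proper) φ
    where
    loopless : ∀ {x y} → x ∈ A → d x y ≡ true → x ≢ y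
    loopless {x} x∈ x→x refl = contradiction (trans (sym (arc⇒adj (oriented φ d∈) x∈ x∈ x→x)) (adj-irrefl x)) λ ()
    adj-proper : ∀ (col : V → Bool) → (∀ {x y} → x ∈ A → y ∈ A → d x y ≡ true → col x ≢ col y) →
      ∀ {u w} → u ∈ A → w ∈ A → adj u w ≡ true → col u ≢ col w
    adj-proper col proper {u} {w} u∈ w∈ a with d u w in eq
    ... | true  = proper u∈ w∈ eq
    ... | false = proper w∈ u∈ (trans (oriented φ d∈ u∈ w∈) (trans (cong₂ (λ a b → a ∧ not b) a eq) refl)) ∘ sym

  -- `e` is the excess of the exponent over the desired n²/4.
  Bound : ℕ → ℕ → Set
  Bound n e = ∀ {A} → Unique A → length A ≡ n → Bounded A (2 ^ ((n * n) / 4 + e))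

  arity>0 : ∀ κ → 0 < arity κ
  arity>0 degᵏ  = s≤s z≤n
  arity>0 outᵏ  = s≤s z≤n
  arity>0 inᵏ   = s≤s z≤n
  arity>0 exp₀ᵏ = ≤-trans (≤-trans (s≤s z≤n) (m≤n+m 3 (2 * k))) m≤q₀
  arity>0 exp₁ᵏ = ≤-trans (arity>0 exp₀ᵏ) q₀≤q₁
  arity>0 pairᵏ = s≤s z≤n

  event-unique : ∀ {A T d} κ → event A (κ , T) d ≡ true → Unique T
  event-unique {T = T} κ e with unique? T
  ... | yes u = u

  -- The members violating goodness at a fixed tuple form a subfamily. Deleting the tuple and
  -- inserting the inductive bound makes it smaller than the target by a factor 2^s.
  event-bound : ∀ {A F e s} j → Unique A → σ * 1024 ≤ length A → s * 64 + (R * R * 16 + 48) ≤ length A →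
    (∀ m → length A ≤ m + R → m < length A → Bound m e) →
    Family A F → j ∈ events A → count (event A j) F * 2 ^ s ≤ 2 ^ ((length A * length A) / 4 + e)
  event-bound {A} {F} {e} {s} (κ , T) uA large hs bounds φ j∈
    with select (event A (κ , T)) F _ ≤-refl
  ... | [] , l , _ , _ = subst (λ z → z * 2 ^ s ≤ 2 ^ ((length A * length A) / 4 + e)) l z≤n
  ... | F′@(d ∷ _) , l , F′⊆F , all =
    subst (λ z → z * 2 ^ s ≤ 2 ^ ((length A * length A) / 4 + e)) l
      (class-exponent (length F′) (length A) (length (A ∖ T)) (arity κ) e s sizes
        (≤-trans (+-monoʳ-≤ (s * 64) (+-monoˡ-≤ 48 (*-monoˡ-≤ 16 (*-mono-≤ (arity≤R κ) (arity≤R κ))))) hs)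
        (event-slack κ T large (proj₁ T-spec) (proj₂ T-spec)
          (bounds (length (A ∖ T))
            (≤-trans (≤-reflexive (sym sizes)) (+-monoʳ-≤ _ (arity≤R κ)))
            (≤-trans (m<m+n (length (A ∖ T)) (arity>0 κ)) (≤-reflexive sizes))
            (Unique-⊆ (∖⊆ A T) uA) refl)
          (subfamily F′⊆F φ)
          (λ d∈ → ∧-right {does (unique? T)} (All.lookup all d∈))))
    where
    T-spec : length T ≡ arity κ × (∀ {u} → u ∈ T → u ∈ A)
    T-spec = ∈-events⁻ {A} {κ} {T} j∈
    sizes : length (A ∖ T) + arity κ ≡ length A
    sizes = trans (cong (length (A ∖ T) +_) (sym (proj₁ T-spec)))
      (length-∖ A T uA (event-unique {A} {T} {d} κ (All.lookup all (here refl))) (proj₂ T-spec))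

  halve : ∀ x y e → x * 2 ≤ 2 ^ (y + e) → x ≤ 2 ^ (y + (e ∸ 1))
  halve x y zero    h = ≤-trans (≤-trans (≤-reflexive (sym (*-identityʳ x))) (*-monoʳ-≤ x (s≤s z≤n))) h
  halve x y (suc e) h = *-cancelʳ-≤ _ _ 2 (begin
    x * 2             ≤⟨ h ⟩
    2 ^ (y + suc e)   ≡⟨ cong (2 ^_) (+-suc y e) ⟩
    2 * 2 ^ (y + e)   ≡⟨ *-comm 2 (2 ^ (y + e)) ⟩
    2 ^ (y + e) * 2   ∎)

  -- If some member avoids all events, it is good and the exact bound holds. Otherwise every member
  -- is counted by an event, and the union bound over at most 6 n^R events, with 12 n^R at most 2^s,
  -- halves the bound.
  step : ∀ {n e s} → σ * 1024 ≤ n → s * 64 + (R * R * 16 + 48) ≤ n → n ^ R * 12 ≤ 2 ^ s →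
    (∀ m → n ≤ m + R → m < n → Bound m e) → Bound n (e ∸ 1)
  step {n} {e} {s} large hs poly bounds {A} uA refl {F} φ
    with search (λ d → 0 <ᵇ ∑ (λ j → bit (event A j d)) (events A)) F
  ... | inj₁ (d , d∈ , none) = ≤-trans (good-bound uA large φ d∈ all-false) (^-monoʳ-≤ 2 (m≤m+n ((n * n) / 4) (e ∸ 1)))
    where
    bit-zero : ∀ {b} → bit b ≤ 0 → b ≡ false
    bit-zero {false} _ = refl
    all-false : ∀ {j} → j ∈ events A → event A j d ≡ false
    all-false j∈ = bit-zero (≤-trans (∑-member (λ j → bit (event A j d)) j∈) (<ᵇ-false none))
  ... | inj₂ hit = halve (length F) ((n * n) / 4) e (*-cancelʳ-≤ _ _ (n ^ R * 6) ⦃ >-nonZero (*-mono-≤ n^R>0 (s≤s (z≤n {5}))) ⦄ (begin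
      length F * 2 * (n ^ R * 6)            ≡⟨ regroup (length F) (n ^ R) ⟩
      length F * (n ^ R * 12)               ≤⟨ *-monoʳ-≤ (length F) poly ⟩
      length F * 2 ^ s                      ≡⟨ cong (_* 2 ^ s) (trans (sym (*-identityʳ (length F))) (sym (∑-const 1 F))) ⟩
      ∑ (λ _ → 1) F * 2 ^ s                 ≤⟨ *-monoˡ-≤ (2 ^ s) (∑-mono F (λ d∈ → <ᵇ-true (hit d∈))) ⟩
      ∑ (λ d → ∑ (λ j → bit (event A j d)) (events A)) F * 2 ^ s
        ≡⟨ cong (_* 2 ^ s) (∑-swap (λ d j → bit (event A j d)) F (events A)) ⟩
      ∑ (λ j → count (event A j) F) (events A) * 2 ^ s
        ≡⟨ sym (∑-*ʳ (λ j → count (event A j) F) (2 ^ s) (events A)) ⟩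
      ∑ (λ j → count (event A j) F * 2 ^ s) (events A)
        ≤⟨ ∑-mono (events A) (λ {j} j∈ → event-bound {s = s} j uA large hs bounds φ j∈) ⟩
      ∑ (λ _ → B) (events A)                ≡⟨ ∑-const B (events A) ⟩
      length (events A) * B                 ≤⟨ *-monoˡ-≤ B (length-events A n>0) ⟩
      6 * n ^ R * B                         ≡⟨ regroup′ (n ^ R) B ⟩
      B * (n ^ R * 6)                       ∎))
    where
    B = 2 ^ ((n * n) / 4 + e)
    n>0 : 0 < n
    n>0 = ≤-trans (≤-trans (s≤s z≤n) (m≤n+m 48 (R * R * 16))) (≤-trans (m≤n+m _ (s * 64)) hs)
    n^R>0 : 0 < n ^ R
    n^R>0 = m^n>0 n ⦃ >-nonZero n>0 ⦄ R
    regroup : ∀ f p → f * 2 * (p * 6) ≡ f * (p * 12)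
    regroup = solve-∀
    regroup′ : ∀ p b → 6 * p * b ≡ b * (p * 6)
    regroup′ = solve-∀

  bound-mono : ∀ {n e e′} → e ≤ e′ → Bound n e → Bound n e′
  bound-mono {n} h b uA l φ = ≤-trans (b uA l φ) (^-monoʳ-≤ 2 (+-monoʳ-≤ ((n * n) / 4) h))

-- Eliminating the excess

abstract
  threshold : ℕ → ℕ → ℕ
  threshold R σ = σ * 1024 + proj₁ (polynomial-slack R (R * R * 16 + 48))

  threshold-spec : ∀ R σ n → threshold R σ ≤ n →
    σ * 1024 ≤ n × ∃ λ s → n ^ R * 12 ≤ 2 ^ s × s * 64 + (R * R * 16 + 48) ≤ n
  threshold-spec R σ n h = ≤-trans (m≤m+n (σ * 1024) _) h ,
    proj₂ (polynomial-slack R (R * R * 16 + 48)) n (≤-trans (m≤n+m _ (σ * 1024)) h)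

-- The excess starts at n₁², and each unit of it is removed at the price of n₁ + R further vertices.
limit : ℕ → ℕ → ℕ
limit R σ = n₁ + n₁ * n₁ * (n₁ + R)
  where n₁ = threshold R σ

module Conclusion {V : Set} (_≟_ : DecidableEquality V) (adj : V → V → Bool)
  (adj-sym : ∀ u v → adj u v ≡ adj v u) (adj-irrefl : ∀ v → adj v v ≡ false)
  (k q₀ q₁ : ℕ) (m≤q₀ : 2 * k + 3 ≤ q₀) (q₀≤q₁ : q₀ ≤ q₁)
  (hq₀ : (1 + 2 * suc q₀ ^ (2 * k + 3)) ^ c * 2 ≤ 2 ^ q₀)
  (hq₁ : (1 + 2 * suc q₁ ^ q₀) ^ c * 2 ≤ 2 ^ q₁) where

  open Counting _≟_ adj adj-sym (2 * k + 3)
  open Induction _≟_ adj adj-sym adj-irrefl k q₀ q₁ m≤q₀ q₀≤q₁ hq₀ hq₁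

  n₁ = threshold R σ

  step-large : ∀ {n e} → n₁ ≤ n → (∀ m → n ≤ m + R → m < n → Bound m e) → Bound n (e ∸ 1)
  step-large {n} h bounds {A} =
    let large , s , poly , hs = threshold-spec R σ n h in step {s = s} large hs poly bounds {A}

  -- Below n₁ the trivial count 2^(n²) is covered by the excess n₁²; from n₁ on, `step` never raises
  -- the excess.
  crude : ∀ n → Bound n (n₁ * n₁)
  crude = <-rec _ λ n rec {A} → by-size n rec {A}
    where
    by-size : ∀ n → (∀ {m} → m < n → Bound m (n₁ * n₁)) → Bound n (n₁ * n₁)
    by-size n rec {A} with n₁ ≤? n
    ... | yes h = bound-mono (m∸n≤m (n₁ * n₁) 1) (λ {A} → step-large h (λ m _ m<n {A} → rec m<n {A}) {A})
    ... | no  h = λ { uA refl φ → ≤-trans (trivial-bound A φ) (^-monoʳ-≤ 2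
            (≤-trans (*-mono-≤ (<⇒≤ (≰⇒> h)) (<⇒≤ (≰⇒> h))) (m≤n+m (n₁ * n₁) ((n * n) / 4)))) }

  -- `step` refers only to the sizes from n - R to n - 1, so raising the threshold by n₁ + R keeps
  -- all of them within reach of the previous round.
  descend : ∀ i n → n₁ + i * (n₁ + R) ≤ n → Bound n (n₁ * n₁ ∸ i)
  descend zero    n h {A} = crude n {A}
  descend (suc i) n h = subst (Bound n) (pred[m∸n]≡m∸[1+n] (n₁ * n₁) i)
    (λ {A} → step-large (≤-trans (m≤m+n n₁ _) h) (λ m n≤m+R _ {A} → descend i m (below n≤m+R) {A}) {A})
    where
    below : ∀ {m} → n ≤ m + R → n₁ + i * (n₁ + R) ≤ m
    below {m} n≤m+R = +-cancelʳ-≤ R _ _ (≤-trans (≤-trans (≤-trans (m≤n+m _ n₁) (≤-reflexive (regroup n₁ (i * (n₁ + R)) R))) h) n≤m+R)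
      where
      regroup : ∀ a b r → a + (a + b + r) ≡ a + (a + r + b)
      regroup = solve-∀

  conclusion : ∀ {A} → Unique A → limit R σ ≤ length A → Bounded A (2 ^ ((length A * length A) / 4))
  conclusion {A} uA h = subst (λ e → Bounded A (2 ^ e))
    (trans (cong ((length A * length A) / 4 +_) (n∸n≡0 (n₁ * n₁))) (+-identityʳ _))
    (descend (n₁ * n₁) (length A) h uA refl)

-- Orientations as digraphs

-- Stated for any `f` with these recursion equations, so that it applies to an enumeration whose
-- name is inaccessible.
boolVecs-spec : {f : ∀ e → List (Vec Bool e)} → f 0 ≡ [] ∷ [] →
  (∀ e → f (suc e) ≡ concatMap (λ x → map (x ∷_) (f e)) (true ∷ false ∷ [])) →
  ∀ e → Unique (f e) × length (f e) ≡ 2 ^ e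
boolVecs-spec {f} z s zero rewrite z = [] ∷ [] , refl
boolVecs-spec {f} z s (suc e) rewrite s e =
  let u , l = boolVecs-spec {f} z s e in
  Unique.++⁺ (Unique.map⁺ Vec.∷-injectiveʳ u) (Unique.++⁺ (Unique.map⁺ Vec.∷-injectiveʳ u) [] (λ ()))
    (λ { (p , q) → differ p q }) ,
  trans (length-++ (map (true ∷_) (f e)))
    (cong₂ _+_ (trans (length-map _ (f e)) l)
      (trans (length-++ (map (false ∷_) (f e))) (cong₂ _+_ (trans (length-map _ (f e)) l) refl)))
  where
  differ : ∀ {v} → v ∈ map (true ∷_) (f e) → v ∈ map (false ∷_) (f e) ++ [] → ⊥
  differ p q with ∈-map⁻ (true ∷_) p | ∈-++⁻ (map (false ∷_) (f e)) q
  ... | _ , _ , refl | inj₁ r with ∈-map⁻ (false ∷_) r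
  ... | _ , _ , ()

enumeration : ∀ {n} (G : Graph n) L → Σ (List (Orientation G)) λ os →
  Σ ((o : Orientation G) → Dec (CycleFree G o L)) λ free? → freeCount G L ≡ length (filter free? os)
-- The enumeration inside freeCount is private to Defs. With filter abstracted to a
-- variable, unification reads the list and the decision procedure off freeCount.
enumeration G L with filter {A = Orientation G} {P = λ o → CycleFree G o L}
... | φ = _ , _ , refl

-- boolVecs and arcsOf are the private functions allVecs and go, found by unification.
mutual
  boolVecs : ∀ e → List (Vec Bool e)
  boolVecs = _

  enumeration≡boolVecs : ∀ {n} (G : Graph n) L → proj₁ (enumeration G L) ≡ boolVecs (length (edges G))
  enumeration≡boolVecs G L with length (edges G)
  ... | e = refl

enumeration-spec : ∀ {n} (G : Graph n) L →
  Unique (proj₁ (enumeration G L)) × length (proj₁ (enumeration G L)) ≡ 2 ^ length (edges G)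
enumeration-spec G L rewrite enumeration≡boolVecs G L = boolVecs-spec {boolVecs} refl (λ _ → refl) (length (edges G))

arcList : ∀ {n} → List (Fin n × Fin n) → List Bool → List (Fin n × Fin n)
arcList ((i , j) ∷ es) (b ∷ bs) = (if b then (i , j) else (j , i)) ∷ arcList es bs
arcList _ _ = []

-- The defining equations determine the function; this identifies the inaccessible arc list with
-- `arcList`.
arcList-unique : ∀ {n} {f : List (Fin n × Fin n) → List Bool → List (Fin n × Fin n)} →
  (∀ bs → f [] bs ≡ []) → (∀ i j es → f ((i , j) ∷ es) [] ≡ []) →
  (∀ i j es b bs → f ((i , j) ∷ es) (b ∷ bs) ≡ (if b then (i , j) else (j , i)) ∷ f es bs) →
  ∀ es bs → f es bs ≡ arcList es bs
arcList-unique h₀ h₁ h₂ [] bs = h₀ bs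
arcList-unique h₀ h₁ h₂ ((i , j) ∷ es) [] = h₁ i j es
arcList-unique h₀ h₁ h₂ ((i , j) ∷ es) (b ∷ bs) = trans (h₂ i j es b bs) (cong (_ ∷_) (arcList-unique h₀ h₁ h₂ es bs))

mutual
  arcsOf : ∀ {n} (G : Graph n) → Orientation G → List (Fin n × Fin n) → List Bool → List (Fin n × Fin n)
  arcsOf = _

  arcs≡arcsOf : ∀ {n} (G : Graph n) (o : Orientation G) → arcs G o ≡ arcsOf G o (edges G) (toList o)
  arcs≡arcsOf G o with edges G | toList o
  ... | es | bs = refl

arcs≡arcList : ∀ {n} (G : Graph n) (o : Orientation G) → arcs G o ≡ arcList (edges G) (toList o)
arcs≡arcList G o = trans (arcs≡arcsOf G o)
  (arcList-unique {f = arcsOf G o} (λ _ → refl) (λ _ _ _ → refl) (λ _ _ _ _ _ → refl) (edges G) (toList o))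

module _ {n : ℕ} where

  Edges : Set
  Edges = List (Fin n × Fin n)

  Ascending : Edges → Set
  Ascending es = ∀ {i j} → (i , j) ∈ es → toℕ i < toℕ j

  arc⇒edge : ∀ (es : Edges) bs {u v} → (u , v) ∈ arcList es bs → (u , v) ∈ es ⊎ (v , u) ∈ es
  arc⇒edge ((i , j) ∷ es) (true  ∷ bs) (here refl) = inj₁ (here refl)
  arc⇒edge ((i , j) ∷ es) (false ∷ bs) (here refl) = inj₂ (here refl)
  arc⇒edge ((i , j) ∷ es) (b ∷ bs)     (there a∈)  = Sum.map there there (arc⇒edge es bs a∈)

  edge⇒arc : ∀ (es : Edges) (o : Vec Bool (length es)) {u v} → (u , v) ∈ es →
    (u , v) ∈ arcList es (toList o) ⊎ (v , u) ∈ arcList es (toList o)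
  edge⇒arc (_ ∷ es) (true  ∷ o) (here refl) = inj₁ (here refl)
  edge⇒arc (_ ∷ es) (false ∷ o) (here refl) = inj₂ (here refl)
  edge⇒arc (_ ∷ es) (b ∷ o)     (there e∈)  = Sum.map there there (edge⇒arc es o e∈)

  head-not-in-tail : ∀ {i j} {es : Edges} → Unique ((i , j) ∷ es) → Ascending ((i , j) ∷ es) →
    (i , j) ∈ es ⊎ (j , i) ∈ es → ⊥
  head-not-in-tail (new ∷ _) asc (inj₁ e∈) = All.lookup new e∈ refl
  head-not-in-tail _         asc (inj₂ e∈) = <-asym (asc (here refl)) (asc (there e∈))

  head-arc-not-in-tail : ∀ b {i j} {es : Edges} bs → Unique ((i , j) ∷ es) → Ascending ((i , j) ∷ es) →
    ∀ {u v} → (u , v) ≡ (if b then (i , j) else (j , i)) →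
    (u , v) ∈ arcList es bs ⊎ (v , u) ∈ arcList es bs → ⊥
  head-arc-not-in-tail true  bs u asc refl (inj₁ a∈) = head-not-in-tail u asc (arc⇒edge _ bs a∈)
  head-arc-not-in-tail true  bs u asc refl (inj₂ a∈) = head-not-in-tail u asc (Sum.swap (arc⇒edge _ bs a∈))
  head-arc-not-in-tail false bs u asc refl (inj₁ a∈) = head-not-in-tail u asc (Sum.swap (arc⇒edge _ bs a∈))
  head-arc-not-in-tail false bs u asc refl (inj₂ a∈) = head-not-in-tail u asc (arc⇒edge _ bs a∈)

  no-opposite-arcs : ∀ (es : Edges) bs → Unique es → Ascending es → ∀ {u v} →
    (u , v) ∈ arcList es bs → (v , u) ∈ arcList es bs → ⊥
  no-opposite-arcs ((i , j) ∷ es) (true  ∷ bs) uq asc (here refl) (here e) =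
    <-irrefl (cong toℕ (sym (,-injectiveˡ e))) (asc (here refl))
  no-opposite-arcs ((i , j) ∷ es) (false ∷ bs) uq asc (here refl) (here e) =
    <-irrefl (cong toℕ (,-injectiveˡ e)) (asc (here refl))
  no-opposite-arcs ((i , j) ∷ es) (b ∷ bs) uq asc (here e) (there a∈) = head-arc-not-in-tail b bs uq asc e (inj₂ a∈)
  no-opposite-arcs ((i , j) ∷ es) (b ∷ bs) uq asc (there a∈) (here e) = head-arc-not-in-tail b bs uq asc e (inj₂ a∈)
  no-opposite-arcs ((i , j) ∷ es) (b ∷ bs) (_ ∷ uq) asc (there a∈) (there a′∈) =
    no-opposite-arcs es bs uq (asc ∘ there) a∈ a′∈

  -- One inclusion suffices: each unordered pair occurs once among the edges and yields exactly one
  -- arc, so every bit can be read off from the arcs.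
  arcList-injective : ∀ (es : Edges) (o o′ : Vec Bool (length es)) → Unique es → Ascending es →
    (∀ {a} → a ∈ arcList es (toList o) → a ∈ arcList es (toList o′)) → o ≡ o′
  arcList-injective []             []       []         _  _   _ = refl
  arcList-injective ((i , j) ∷ es) (b ∷ o) (b′ ∷ o′) uq@(_ ∷ uq′) asc sub =
    cong₂ _∷_ (same-bit b b′ sub) (arcList-injective es o o′ uq′ (asc ∘ there) tail-sub)
    where
    i≢j : i ≢ j
    i≢j i≡j = <-irrefl (cong toℕ i≡j) (asc (here refl))
    same-bit : ∀ b b′ → (∀ {a} → a ∈ arcList ((i , j) ∷ es) (b ∷ toList o) →
      a ∈ arcList ((i , j) ∷ es) (b′ ∷ toList o′)) → b ≡ b′
    same-bit true  true  _ = refl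
    same-bit false false _ = refl
    same-bit true false sub with sub (here refl)
    ... | here e   = ⊥-elim (i≢j (,-injectiveˡ e))
    ... | there a∈ = ⊥-elim (head-arc-not-in-tail true (toList o′) uq asc refl (inj₁ a∈))
    same-bit false true sub with sub (here refl)
    ... | here e   = ⊥-elim (i≢j (,-injectiveʳ e))
    ... | there a∈ = ⊥-elim (head-arc-not-in-tail false (toList o′) uq asc refl (inj₁ a∈))
    tail-sub : ∀ {a} → a ∈ arcList es (toList o) → a ∈ arcList es (toList o′)
    tail-sub {u , v} a∈ with sub (there a∈)
    ... | there a∈′ = a∈′
    ... | here e = ⊥-elim (head-arc-not-in-tail b′ (toList o) uq asc e (inj₁ a∈))

edges-unique : ∀ {n} (G : Graph n) → Unique (edges G)
edges-unique {n} G = Unique.filter⁺ _ (Unique.filter⁺ _ (Unique.cartesianProduct⁺ (Unique.allFin⁺ n) (Unique.allFin⁺ n)))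

∈-edges⁻ : ∀ {n} (G : Graph n) {i j} → (i , j) ∈ edges G → toℕ i < toℕ j × adj G i j ≡ true
∈-edges⁻ {n} G e∈ =
  let e∈′ , a = ∈-filter⁻ (λ p → adj G (proj₁ p) (proj₂ p) Bool.≟ true) {xs = pairs n} e∈
      _ , lt  = ∈-filter⁻ (λ p → toℕ (proj₁ p) <? toℕ (proj₂ p)) {xs = cartesianProduct (allFin n) (allFin n)} e∈′
  in lt , a

∈-edges⁺ : ∀ {n} (G : Graph n) {i j} → toℕ i < toℕ j → adj G i j ≡ true → (i , j) ∈ edges G
∈-edges⁺ G {i} {j} lt a = ∈-filter⁺ _ (∈-filter⁺ _ (∈-cartesianProduct⁺ (∈-allFin i) (∈-allFin j)) lt) a

module _ {n : ℕ} (G : Graph n) where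

  ascending : Ascending (edges G)
  ascending = proj₁ ∘ ∈-edges⁻ G

  digraph : Orientation G → Digraph (Fin n)
  digraph o u v = does (MemDec._∈?_ (≡-dec _≟ᶠ_ _≟ᶠ_) (u , v) (arcs G o))

  digraph⇒Arc : ∀ o {u v} → digraph o u v ≡ true → Arc G o u v
  digraph⇒Arc o {u} {v} e with MemDec._∈?_ (≡-dec _≟ᶠ_ _≟ᶠ_) (u , v) (arcs G o)
  ... | yes a = a

  Arc⇒digraph : ∀ o {u v} → Arc G o u v → digraph o u v ≡ true
  Arc⇒digraph o {u} {v} a with MemDec._∈?_ (≡-dec _≟ᶠ_ _≟ᶠ_) (u , v) (arcs G o)
  ... | yes _ = refl
  ... | no ¬a = contradiction a ¬a

  Arc⇒adj : ∀ o {u v} → Arc G o u v → adj G u v ≡ true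
  Arc⇒adj o {u} {v} a with arc⇒edge (edges G) (toList o) (subst ((u , v) ∈_) (arcs≡arcList G o) a)
  ... | inj₁ e∈ = proj₂ (∈-edges⁻ G e∈)
  ... | inj₂ e∈ = trans (Graph.sym G u v) (proj₂ (∈-edges⁻ G e∈))

  adj⇒Arc : ∀ o {u v} → adj G u v ≡ true → Arc G o u v ⊎ Arc G o v u
  adj⇒Arc o {u} {v} a with <-cmp (toℕ u) (toℕ v)
  ... | tri< lt _ _ = Sum.map to to (edge⇒arc (edges G) o (∈-edges⁺ G lt a))
    where
    to : ∀ {e} → e ∈ arcList (edges G) (toList o) → e ∈ arcs G o
    to = subst (_ ∈_) (sym (arcs≡arcList G o))
  ... | tri> _ _ gt = Sum.swap (Sum.map to to (edge⇒arc (edges G) o (∈-edges⁺ G gt (trans (Graph.sym G v u) a))))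
    where
    to : ∀ {e} → e ∈ arcList (edges G) (toList o) → e ∈ arcs G o
    to = subst (_ ∈_) (sym (arcs≡arcList G o))
  ... | tri≈ _ e _ with refl ← toℕ-injective e = contradiction (trans (sym a) (irrefl G u)) λ ()

  Arc-asym : ∀ o {u v} → Arc G o u v → Arc G o v u → ⊥
  Arc-asym o a a′ = no-opposite-arcs (edges G) (toList o) (edges-unique G) ascending (from a) (from a′)
    where
    from : ∀ {e} → e ∈ arcs G o → e ∈ arcList (edges G) (toList o)
    from = subst (_ ∈_) (arcs≡arcList G o)

  digraph-oriented : ∀ o u w → digraph o w u ≡ adj G u w ∧ not (digraph o u w)
  digraph-oriented o u w with digraph o w u in wu | digraph o u w in uw | adj G u w in a
  ... | true  | true  | _     = ⊥-elim (Arc-asym o (digraph⇒Arc o wu) (digraph⇒Arc o uw))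
  ... | true  | false | true  = refl
  ... | true  | false | false = contradiction (trans (sym (trans (Graph.sym G u w) (Arc⇒adj o (digraph⇒Arc o wu)))) a) λ ()
  ... | false | true  | true  = refl
  ... | false | true  | false = refl
  ... | false | false | false = refl
  ... | false | false | true with adj⇒Arc o a
  ... | inj₁ uw′ = contradiction (trans (sym (Arc⇒digraph o uw′)) uw) λ ()
  ... | inj₂ wu′ = contradiction (trans (sym (Arc⇒digraph o wu′)) wu) λ ()

  Path⇒DirPath : ∀ o {x ys z y} → Path (digraph o) x ys z → digraph o z y ≡ true → DirPath G o ((x ∷ ys) ++ y ∷ [])
  Path⇒DirPath o []      e = digraph⇒Arc o e , tt
  Path⇒DirPath o (a ∷ π) e = digraph⇒Arc o a , Path⇒DirPath o π e

  CycleFree⇒Free : ∀ o L → CycleFree G o L → Free L (allFin n) (digraph o)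
  CycleFree⇒Free o L free {x} {ys} π e u _ refl = free
    (Vec.fromList (x ∷ ys) , subst Unique (sym eq) u , subst (DirClosed G o) (sym eq) (Path⇒DirPath o π e))
    where
    eq : toList (Vec.fromList (x ∷ ys)) ≡ x ∷ ys
    eq = Vec.toList∘fromList (x ∷ ys)

  digraph-injective : ∀ o o′ → (∀ u w → digraph o u w ≡ digraph o′ u w) → o ≡ o′
  digraph-injective o o′ h = arcList-injective (edges G) o o′ (edges-unique G) ascending λ { {u , w} a∈ →
    subst ((u , w) ∈_) (arcs≡arcList G o′) (digraph⇒Arc o′ (trans (sym (h u w))
      (Arc⇒digraph o (subst ((u , w) ∈_) (sym (arcs≡arcList G o)) a∈)))) }

  open Counting _≟ᶠ_ (adj G) (Graph.sym G)

  orientations-family : ∀ L os → Unique os → (∀ {o} → o ∈ os → CycleFree G o L) →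
    Family L (allFin n) (map digraph os)
  orientations-family L os u free = family
    (λ d∈ {u} {w} _ _ → let o , o∈ , e = ∈-map⁻ digraph d∈ in
      subst (λ d → d w u ≡ adj G u w ∧ not (d u w)) (sym e) (digraph-oriented o u w))
    (λ d∈ → let o , o∈ , e = ∈-map⁻ digraph d∈ in subst (Free L (allFin n)) (sym e) (CycleFree⇒Free o L (free o∈)))
    (distinct u)
    where
    distinct : ∀ {os} → Unique os → AllPairs (λ d e → ¬ Agree L (allFin n) d e) (map digraph os)
    distinct [] = []
    distinct {o ∷ os} (new ∷ u) = All.tabulate (λ e∈ agree → let o′ , o′∈ , eq = ∈-map⁻ digraph e∈ in
      All.lookup new o′∈ (digraph-injective o o′ (λ u w →
        trans (agree (∈-allFin u) (∈-allFin w)) (cong (λ d → d u w) eq)))) ∷ distinct u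

  freeCount-≤ : ∀ L N → Bounded L (allFin n) N → freeCount G L ≤ N
  freeCount-≤ L N bound = let os , free? , eq = enumeration G L in begin
    freeCount G L                              ≡⟨ eq ⟩
    length (filter free? os)                   ≡⟨ sym (length-map digraph (filter free? os)) ⟩
    length (map digraph (filter free? os))
      ≤⟨ bound (orientations-family L (filter free? os) (Unique.filter⁺ free? (proj₁ (enumeration-spec G L)))
           (λ o∈ → proj₂ (∈-filter⁻ free? {xs = os} o∈))) ⟩
    N                                          ∎

-- The extremal graph

length-⊆ : ∀ {X : Set} (_≟_ : DecidableEquality X) {xs ys : List X} → Unique xs →
  (∀ {x} → x ∈ xs → x ∈ ys) → length xs ≤ length ys
length-⊆ _≟_ {xs} {ys} u sub = ≮⇒≥ λ h →
  let x , x∈ , _ , x∉ = fresh _≟_ (λ _ → true) xs ys u (≤-trans h (≤-reflexive (sym (count-true xs))))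
  in x∉ (sub x∈)

length-filter-≟ : ∀ {X : Set} (p : X → Bool) b xs →
  length (filter (λ x → p x Bool.≟ b) xs) ≡ count (λ x → not (p x xor b)) xs
length-filter-≟ p b     []       = refl
length-filter-≟ p true  (x ∷ xs) with p x
... | true  = cong suc (length-filter-≟ p true xs)
... | false = length-filter-≟ p true xs
length-filter-≟ p false (x ∷ xs) with p x
... | true  = length-filter-≟ p false xs
... | false = cong suc (length-filter-≟ p false xs)

count-initial : ∀ n h → h ≤ n → count (λ i → toℕ i <ᵇ h) (allFin n) ≡ h
count-initial n zero _ = trans (∑-const 0 (allFin n)) (*-zeroʳ (length (allFin n)))
count-initial (suc n) (suc h) (s≤s h≤n) = cong suc (begin-equality
  ∑ (λ i → bit (toℕ i <ᵇ suc h)) (tabulate {n = n} Fin.suc) ≡⟨ cong (∑ (λ i → bit (toℕ i <ᵇ suc h))) (sym (map-tabulate {n = n} (λ i → i) Fin.suc)) ⟩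
  ∑ (λ i → bit (toℕ i <ᵇ suc h)) (map Fin.suc (allFin n)) ≡⟨ ∑-map _ Fin.suc (allFin n) ⟩
  count (λ i → toℕ i <ᵇ h) (allFin n)                     ≡⟨ count-initial n h h≤n ⟩
  h                                                       ∎)

-- With n = 2h + r the parts are h and h + r, and n² = 4h(h + r) + r² with r² < 4.
balanced-product : ∀ n → n / 2 * (n ∸ n / 2) ≡ (n * n) / 4
balanced-product n = ≤-antisym lower upper
  where
  h = n / 2
  n≡ : h + (n ∸ h) ≡ n
  n≡ = m+[n∸m]≡n (≤-trans (≤-trans (≤-reflexive (sym (*-identityʳ h))) (*-monoʳ-≤ h (s≤s z≤n))) (m/n*n≤m n 2))
  lower : h * (n ∸ h) ≤ (n * n) / 4
  lower = ≤-trans (ab≤[a+b]²/4 h (n ∸ h)) (≤-reflexive (cong (λ l → (l * l) / 4) n≡))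
  r = n % 2
  n≡r : n ≡ r + h * 2
  n≡r = m≡m%n+[m/n]*n n 2
  rest : n ∸ h ≡ r + h
  rest = +-cancelˡ-≡ h _ _ (trans n≡ (trans n≡r (regroup r h)))
    where
    regroup : ∀ r h → r + h * 2 ≡ h + (r + h)
    regroup = solve-∀
  r*r<4 : r * r < 4
  r*r<4 = s≤s (≤-trans (*-mono-≤ (s≤s⁻¹ (m%n<n n 2)) (s≤s⁻¹ (m%n<n n 2))) (s≤s z≤n))
  upper : (n * n) / 4 ≤ h * (n ∸ h)
  upper = s≤s⁻¹ (m<n*o⇒m/o<n (begin-strict
    n * n                         ≡⟨ cong₂ _*_ n≡r n≡r ⟩
    (r + h * 2) * (r + h * 2)     ≡⟨ square r h ⟩
    r * r + h * (r + h) * 4       <⟨ +-monoˡ-< (h * (r + h) * 4) r*r<4 ⟩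
    4 + h * (r + h) * 4           ≡⟨ cong (λ z → 4 + h * z * 4) (sym rest) ⟩
    suc (h * (n ∸ h)) * 4         ∎))
    where
    square : ∀ r h → (r + h * 2) * (r + h * 2) ≡ r * r + h * (r + h) * 4
    square = solve-∀

xor-true : ∀ {a b} → a xor b ≡ true → b ≡ not a
xor-true {true}  {false} _ = refl
xor-true {false} {true}  _ = refl

odd : ℕ → Bool
odd zero    = false
odd (suc n) = not (odd n)

odd-2k+1 : ∀ k → odd (2 * k + 1) ≡ true
odd-2k+1 zero    = refl
odd-2k+1 (suc k) = trans (cong odd (step k)) (trans (Bool.not-involutive _) (odd-2k+1 k))
  where
  step : ∀ k → 2 * suc k + 1 ≡ suc (suc (2 * k + 1))
  step = solve-∀

module Bipartite (n : ℕ) where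

  side : Fin n → Bool
  side i = toℕ i <ᵇ n / 2

  graph : Graph n
  graph = record
    { adj    = λ i j → side i xor side j
    ; sym    = λ i j → Bool.xor-comm (side i) (side j)
    ; irrefl = λ i → Bool.xor-same (side i)
    }

  A₁ A₂ : List (Fin n)
  A₁ = filter (λ i → side i Bool.≟ true) (allFin n)
  A₂ = filter (λ i → side i Bool.≟ false) (allFin n)

  edge⇒product : ∀ {e} → e ∈ edges graph → e ∈ cartesianProduct A₁ A₂
  edge⇒product {i , j} e∈ with lt , a ← ∈-edges⁻ graph e∈ with side i in si | side j in sj
  ... | true  | false = ∈-cartesianProduct⁺ (∈-filter⁺ _ (∈-allFin i) si) (∈-filter⁺ _ (∈-allFin j) sj)
  -- Impossible, since edges are listed in ascending order and the `true` side is an initial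
  -- segment.
  ... | false | true  = contradiction (trans (sym (Equivalence.to Bool.T-≡ (<⇒<ᵇ (<-trans lt (<ᵇ-true {n = n / 2} sj))))) si) λ ()

  product⇒edge : ∀ {e} → e ∈ cartesianProduct A₁ A₂ → e ∈ edges graph
  product⇒edge {i , j} e∈ =
    let i∈ , j∈ = ∈-cartesianProduct⁻ A₁ A₂ e∈
        si = proj₂ (∈-filter⁻ (λ i → side i Bool.≟ true) {xs = allFin n} i∈)
        sj = proj₂ (∈-filter⁻ (λ i → side i Bool.≟ false) {xs = allFin n} j∈)
    in ∈-edges⁺ graph (<-≤-trans (<ᵇ-true {n = n / 2} si) (<ᵇ-false sj)) (cong₂ _xor_ si sj)

  length-edges : length (edges graph) ≡ (n * n) / 4
  length-edges = begin-equality
    length (edges graph)              ≡⟨ ≤-antisym (length-⊆ pair≟ (edges-unique graph) edge⇒product)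
                                                   (length-⊆ pair≟ product-unique product⇒edge) ⟩
    length (cartesianProduct A₁ A₂)   ≡⟨ length-cartesianProduct A₁ A₂ ⟩
    length A₁ * length A₂             ≡⟨ cong₂ _*_ length-A₁ length-A₂ ⟩
    n / 2 * (n ∸ n / 2)               ≡⟨ balanced-product n ⟩
    (n * n) / 4                       ∎
    where
    pair≟ = ≡-dec _≟ᶠ_ _≟ᶠ_
    product-unique = Unique.cartesianProduct⁺ (Unique.filter⁺ (λ i → side i Bool.≟ true) (Unique.allFin⁺ n))
                                              (Unique.filter⁺ (λ i → side i Bool.≟ false) (Unique.allFin⁺ n))
    xor-not : ∀ b → not (b xor true) ≡ b
    xor-not true  = refl
    xor-not false = refl
    ∑-cong : ∀ {f g : Fin n → ℕ} xs → (∀ x → f x ≡ g x) → ∑ f xs ≡ ∑ g xs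
    ∑-cong xs h = ≤-antisym (∑-mono xs (λ {x} _ → ≤-reflexive (h x))) (∑-mono xs (λ {x} _ → ≤-reflexive (sym (h x))))
    length-A₁ : length A₁ ≡ n / 2
    length-A₁ = trans (length-filter-≟ side true (allFin n))
      (trans (∑-cong (allFin n) (λ i → cong bit (xor-not (side i)))) (count-initial n (n / 2) (m/n≤m n 2)))
    length-A₂ : length A₂ ≡ n ∸ n / 2
    length-A₂ = trans (length-filter-≟ side false (allFin n))
      (trans (∑-cong (allFin n) (λ i → cong (bit ∘ not) (Bool.xor-identityʳ (side i))))
        (trans (sym (m+n∸m≡n (count side (allFin n)) _))
          (cong₂ _∸_ (trans (count-not side (allFin n)) (length-tabulate (λ i → i))) (count-initial n (n / 2) (m/n≤m n 2)))))

  -- Every arc changes sides, so the parity of the number of steps decides the final side; a closed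
  -- walk of odd length would end on the wrong one.
  sides-alternate : ∀ o x xs y → DirPath graph o (x ∷ xs ++ y ∷ []) → side y ≡ side x xor odd (suc (length xs))
  sides-alternate o x []       y (a , _) = trans (xor-true {side x} (Arc⇒adj graph o a)) (sym (Bool.xor-comm (side x) true))
  sides-alternate o x (z ∷ xs) y (a , π) = trans (sides-alternate o z xs y π)
    (trans (cong (_xor odd (suc (length xs))) (xor-true {side x} (Arc⇒adj graph o a))) (shift (side x) _))
    where
    shift : ∀ a b → not a xor b ≡ a xor not b
    shift true  b = sym (Bool.not-involutive b)
    shift false b = refl

  no-odd-cycle : ∀ o xs → odd (length xs) ≡ true → DirClosed graph o xs → ⊥
  no-odd-cycle o (x ∷ xs) od π = absurd (side x) (trans (sides-alternate o x xs x π) (cong (side x xor_) od))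
    where
    absurd : ∀ b → b ≡ b xor true → ⊥
    absurd true  ()
    absurd false ()

  all-free : ∀ k o → CycleFree graph o (2 * k + 1)
  all-free k o (c , _ , π) = no-odd-cycle o (toList c) (trans (cong odd (Vec.length-toList c)) (odd-2k+1 k)) π

  freeCount-graph : ∀ k → freeCount graph (2 * k + 1) ≡ 2 ^ ((n * n) / 4)
  freeCount-graph k = let os , free? , eq = enumeration graph (2 * k + 1) in begin-equality
    freeCount graph (2 * k + 1) ≡⟨ eq ⟩
    length (filter free? os)    ≡⟨ cong length (filter-all free? (All.universal (all-free k) os)) ⟩
    length os                   ≡⟨ proj₂ (enumeration-spec graph (2 * k + 1)) ⟩
    2 ^ length (edges graph)    ≡⟨ cong (2 ^_) length-edges ⟩
    2 ^ ((n * n) / 4)           ∎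

theorem1p1 : (k : ℕ) → k ≥ 1 →
    Σ ℕ (λ n₀ → (n : ℕ) → n ≥ n₀ → D≡ n (2 * k + 1) (2 ^ ((n * n) / 4)))
theorem1p1 (suc k) _
  -- The forbidden length is now 2k + 3. First q₀ is taken large against this length, then q₁ large
  -- against q₀; both depend on k only.
  with q₀ , m≤q₀ , hq₀ ← expansion-size (2 * k + 3) (2 * k + 3)
  with q₁ , q₀≤q₁ , hq₁ ← expansion-size q₀ q₀
  = n₀ , λ n n₀≤n → upper n n₀≤n , Bipartite.graph n , Bipartite.freeCount-graph n (suc k)
  where
  n₀ = limit (suc (suc (q₀ + q₁))) (4 * q₁ + (2 ^ q₁ * q₀ + q₀))
  L≡ : ∀ k → 2 * k + 3 ≡ 2 * suc k + 1
  L≡ = solve-∀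
  upper : ∀ n → n ≥ n₀ → (G : Graph n) → freeCount G (2 * suc k + 1) ≤ 2 ^ ((n * n) / 4)
  upper n n₀≤n G = subst (λ L → freeCount G L ≤ 2 ^ ((n * n) / 4)) (L≡ k)
    (freeCount-≤ G (2 * k + 3) _ (subst (λ l → Counting.Bounded _≟ᶠ_ (adj G) (Graph.sym G) (2 * k + 3) (allFin n) (2 ^ ((l * l) / 4)))
      size
      (Conclusion.conclusion _≟ᶠ_ (adj G) (Graph.sym G) (irrefl G) k q₀ q₁ m≤q₀ q₀≤q₁ hq₀ hq₁ (Unique.allFin⁺ n)
        (≤-trans n₀≤n (≤-reflexive (sym size))))))
    where
    size : length (allFin n) ≡ n
    size = length-tabulate (λ i → i)
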